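{- Let $t$ be a positive integer and let $S$ be a skew-symmetric Seidel matrix of order $4t+1$ with spectrum $\{[\pm\sqrt{ -4t-3}]^{2t-1},[\pm\sqrt{ -3}]^1,[0]^1\}$. Then there exists a vector $\mathbf x\in\{\pm1\}^{4t+1}$ such that the matrix \[\begin{pmatrix} S & \mathbf x\\ -\mathbf x^\top & 0\end{pmatrix}\] is a skew-symmetric Seidel matrix with spectrum $\{[\pm\sqrt{ -4t-3}]^{2t},[\pm\sqrt{ -1}]^1\}$.
   Context: A Seidel matrix is a square $\{0,\pm1\}$-matrix $S$ with zero diagonal, all off-diagonal entries nonzero, and $S=\pm S^\top$; it is skew-symmetric if $S^\top=-S$. The spectrum is written $\{[\theta_1]^{m_1},\dots,[\theta_r]^{m_r}\}$ where $\theta_i$ are the distinct eigenvalues and $m_i$ their algebraic multiplicities; $[\pm\theta]^m$ means both $\theta$ and $-\theta$ with multiplicity $m$. -}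

module Defs where

open import Data.Nat using (ℕ; zero; suc)
open import Data.Integer using (ℤ; +_; -_; _+_; _*_; -1ℤ; 0ℤ; 1ℤ)
open import Data.Fin using (Fin; zero; suc; toℕ; punchIn; _≟_)
open import Data.List using (List; []; _∷_; map)
open import Data.Maybe using (Maybe; just; nothing)
import Data.Maybe as Maybe
open import Data.Sum using (_⊎_)
open import Data.Product using (_×_)
open import Relation.Binary.PropositionalEquality using (_≡_; _≢_)
open import Relation.Nullary using (does)
open import Data.Bool using (if_then_else_)

Matrix : ℕ → Set
Matrix n = Fin n → Fin n → ℤ

IsSkewSeidel : ∀ {n} → Matrix n → Set
IsSkewSeidel {n} S =
  (∀ (i : Fin n) → S i i ≡ 0ℤ) ×
  (∀ (i j : Fin n) → i ≢ j → (S i j ≡ 1ℤ ⊎ S i j ≡ -1ℤ)) ×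
  (∀ (i j : Fin n) → S j i ≡ - S i j)

-- Polynomials over ℤ as coefficient lists (lowest degree first)

Poly : Set
Poly = List ℤ

infixl 6 _+P_
infixl 7 _*P_
infixr 8 _^P_

_+P_ : Poly → Poly → Poly
[] +P q = q
(a ∷ p) +P [] = a ∷ p
(a ∷ p) +P (b ∷ q) = (a + b) ∷ (p +P q)

scale : ℤ → Poly → Poly
scale a p = map (a *_) p

_*P_ : Poly → Poly → Poly
[] *P q = []
(a ∷ p) *P q = scale a q +P (0ℤ ∷ (p *P q))

_^P_ : Poly → ℕ → Poly
p ^P zero = 1ℤ ∷ []
p ^P suc k = p *P (p ^P k)

X : Poly
X = 0ℤ ∷ 1ℤ ∷ []

C : ℤ → Poly
C a = a ∷ []

coeff : Poly → ℕ → ℤ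
coeff [] k = 0ℤ
coeff (a ∷ p) zero = a
coeff (a ∷ p) (suc k) = coeff p k

-- Equality of polynomials (coefficientwise; ignores trailing zeros)
_≈P_ : Poly → Poly → Set
p ≈P q = ∀ (k : ℕ) → coeff p k ≡ coeff q k

sumP : ∀ {m} → (Fin m → Poly) → Poly
sumP {zero} f = []
sumP {suc m} f = f zero +P sumP (λ j → f (suc j))

sign : ℕ → ℤ
sign zero = 1ℤ
sign (suc k) = - sign k

det : ∀ {n} → (Fin n → Fin n → Poly) → Poly
det {zero} M = 1ℤ ∷ []
det {suc n} M =
  sumP (λ j → scale (sign (toℕ j))
                    (M zero j *P det (λ i k → M (suc i) (punchIn j k))))

charPoly : ∀ {n} → Matrix n → Poly
charPoly S = det (λ i j → (if does (i ≟ j) then X else []) +P C (- S i j))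

lastView : ∀ {n} → Fin (suc n) → Maybe (Fin n)
lastView {zero} zero = nothing
lastView {suc n} zero = just zero
lastView {suc n} (suc i) = Maybe.map suc (lastView i)

border : ∀ {n} → Matrix n → (Fin n → ℤ) → Matrix (suc n)
border S x i j with lastView i | lastView j
... | just a  | just b  = S a b
... | just a  | nothing = x a
... | nothing | just b  = - x b
... | nothing | nothing = 0ℤ

{-# OPTIONS --safe #-}
module Submission where

-- Put M = S² + 4t + 3. By Cayley–Hamilton, and because a symmetric integer matrix has no nilpotent part,
-- S M (S² + 3) = 0; hence M is positive semidefinite with eigenvalues among 0, 4t, 4t + 3, and its entries
-- are 3 on the diagonal and odd elsewhere, so they lie in {±1, ±3}. The matrix F = M (S² + 3) has its columns in
-- ker S, which is a line (already modulo 2), so F has rank one. Writing F_ii = 8 d_i + 1, the trace of F gives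
-- Σ d_i = t + 1, and counting the rows parallel to a given row of M shows d_i ∈ {0, 1}, both values occurring.
-- For d_a = 1, d_b = 0 and ε = M_ab the vector x = M (e_a − ε e_b) / 2 has entries ±1. Since S³ x = −3 S x, the
-- vector (X I − S)⁻¹ x is explicit, and column operations compute the characteristic polynomial of the
-- bordered matrix.

-- Apart from the final cancellation, the spectrum enters only through the annihilating polynomial.
-- No eigenvectors or real numbers occur: eigenvalue inequalities become identities between integer
-- forms, obtained from F² = 3 (4t + 3) F and M² = F + 4t M. That the kernel is a line is also
-- arithmetic: modulo 2 every skew Seidel matrix is J - I. Counting: rows of M joined by an entry ±3
-- agree up to sign. The norm of row a and M² = F + 4t M show that t + d_a rows are parallel to row
-- a, all with the same d, so (t + d_a) d_a ≤ Σ d_i = t + 1, whence d_a ≤ 1. Choice of a and b: F_aa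
-- = 9 and F_bb = 1 give F_ab = ±3 by rank one. The entries of x are at first only known to be 0 or
-- ±1. With u = e_a - ε e_b the number of zeros is 1 - ⟨u, F u⟩ / 4, where ⟨u, F u⟩ is 4 or 16;
-- being nonnegative, it is 0. Bordering: (X I - S)⁻¹ x has denominator X (X² + 3), so the column
-- operations are done after multiplying by it. It is cancelled at the end against the same two
-- factors of the characteristic polynomial of S.

module Determinants where

  open import Algebra.Bundles using (CommutativeRing)
  open import Data.Bool using (if_then_else_)
  open import Data.Fin using (Fin; zero; suc; toℕ; fromℕ; inject₁; punchIn; punchOut; _≟_; _<_)
  open import Data.Fin.Properties
    using (punchIn-punchOut; punchInᵢ≢i; punchIn-injective; suc-injective; toℕ-inject₁; <-trans; <-irrefl; <⇒≢; fromℕ≢inject₁)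
  open import Data.Nat using (ℕ; zero; suc; s≤s; z≤n)
  open import Data.Product using (∃₂; _×_; _,_)
  open import Data.Sum using (_⊎_; inj₁; inj₂)
  open import Data.Vec.Functional using (updateAt)
  open import Data.Vec.Functional.Properties using (updateAt-updates; updateAt-minimal)
  open import Function using (const; _∘_)
  open import Relation.Binary.PropositionalEquality as ≡ using (_≡_; _≢_)
  open import Relation.Nullary using (yes; no; does; contradiction)

  -- Adjacent column indices and their behaviour under deletion of a column

  data Adjacent : ∀ {n} → Fin n → Fin n → Set where
    here  : ∀ {n} → Adjacent {suc (suc n)} zero (suc zero)
    there : ∀ {n} {c d : Fin n} → Adjacent c d → Adjacent (suc c) (suc d)

  adjacent⇒< : ∀ {n} {c d : Fin n} → Adjacent c d → c < d
  adjacent⇒< here = s≤s z≤n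
  adjacent⇒< (there a) = s≤s (adjacent⇒< a)

  adjacent⇒≢ : ∀ {n} {c d : Fin n} → Adjacent c d → c ≢ d
  adjacent⇒≢ a = <⇒≢ (adjacent⇒< a)

  punchIn-adjacent : ∀ {n} (j : Fin (suc n)) {c d} → j ≢ c → j ≢ d → Adjacent c d →
    ∃₂ λ c′ d′ → punchIn j c′ ≡ c × punchIn j d′ ≡ d × Adjacent c′ d′
  punchIn-adjacent zero j≢c j≢d here = contradiction ≡.refl j≢c
  punchIn-adjacent zero j≢c j≢d (there a) = _ , _ , ≡.refl , ≡.refl , a
  punchIn-adjacent (suc zero) j≢c j≢d here = contradiction ≡.refl j≢d
  punchIn-adjacent {suc (suc n)} (suc (suc j)) j≢c j≢d here = zero , suc zero , ≡.refl , ≡.refl , here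
  punchIn-adjacent {suc n} (suc j) j≢c j≢d (there a)
    with punchIn-adjacent j (j≢c ∘ ≡.cong suc) (j≢d ∘ ≡.cong suc) a
  ... | c′ , d′ , p , q , a′ = suc c′ , suc d′ , ≡.cong suc p , ≡.cong suc q , there a′

  -- Compares the minors obtained by deleting column c or column d: they differ in one position
  -- only, where each shows the column deleted by the other.
  punchIn-of-adjacent : ∀ {n} {c d : Fin (suc n)} → Adjacent c d → ∀ k →
    punchIn c k ≡ punchIn d k ⊎ (punchIn c k ≡ d × punchIn d k ≡ c)
  punchIn-of-adjacent here zero = inj₂ (≡.refl , ≡.refl)
  punchIn-of-adjacent here (suc k) = inj₁ ≡.refl
  punchIn-of-adjacent {suc n} (there a) zero = inj₁ ≡.refl
  punchIn-of-adjacent {suc n} (there a) (suc k) with punchIn-of-adjacent a k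
  ... | inj₁ p = inj₁ (≡.cong suc p)
  ... | inj₂ (p , q) = inj₂ (≡.cong suc p , ≡.cong suc q)

  -- A chain of adjacent steps rather than an inequality of numbers, so that a column can be carried
  -- along it by neighbour swaps.
  data _≺_ {n} (c : Fin n) : Fin n → Set where
    step : ∀ {d} → Adjacent c d → c ≺ d
    _▸_  : ∀ {d e} → c ≺ d → Adjacent d e → c ≺ e

  ≺-suc : ∀ {n} {c d : Fin n} → c ≺ d → suc c ≺ suc d
  ≺-suc (step a) = step (there a)
  ≺-suc (p ▸ a) = ≺-suc p ▸ there a

  ≺-from : ∀ {n} {b c d : Fin n} → Adjacent b c → c ≺ d → b ≺ d
  ≺-from a (step b) = step a ▸ b
  ≺-from a (p ▸ b) = ≺-from a p ▸ b

  zero≺suc : ∀ {n} (d : Fin n) → zero ≺ suc d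
  zero≺suc zero = step here
  zero≺suc (suc d) = ≺-from here (≺-suc (zero≺suc d))

  ≺-total : ∀ {n} (c d : Fin n) → c ≢ d → c ≺ d ⊎ d ≺ c
  ≺-total zero zero c≢d = contradiction ≡.refl c≢d
  ≺-total zero (suc d) c≢d = inj₁ (zero≺suc d)
  ≺-total (suc c) zero c≢d = inj₂ (zero≺suc c)
  ≺-total (suc c) (suc d) c≢d with ≺-total c d (c≢d ∘ ≡.cong suc)
  ... | inj₁ p = inj₁ (≺-suc p)
  ... | inj₂ p = inj₂ (≺-suc p)

  ≺⇒< : ∀ {n} {c d : Fin n} → c ≺ d → c < d
  ≺⇒< (step a) = adjacent⇒< a
  ≺⇒< (p ▸ a) = <-trans (≺⇒< p) (adjacent⇒< a)

  ≺⇒≢ : ∀ {n} {c d : Fin n} → c ≺ d → c ≢ d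
  ≺⇒≢ c≺d ≡.refl = <-irrefl ≡.refl (≺⇒< c≺d)

  punchIn-inject₁ : ∀ {n} (j : Fin (suc n)) (k : Fin n) →
    punchIn (inject₁ j) (inject₁ k) ≡ inject₁ (punchIn j k)
  punchIn-inject₁ zero k = ≡.refl
  punchIn-inject₁ (suc j) zero = ≡.refl
  punchIn-inject₁ (suc j) (suc k) = ≡.cong suc (punchIn-inject₁ j k)

  punchIn-inject₁-fromℕ : ∀ {n} (j : Fin (suc n)) → punchIn (inject₁ j) (fromℕ n) ≡ fromℕ (suc n)
  punchIn-inject₁-fromℕ zero = ≡.refl
  punchIn-inject₁-fromℕ {suc n} (suc j) = ≡.cong suc (punchIn-inject₁-fromℕ j)

  -- Determinants over a commutative ring, from the expansion along the first row

  module Determinant {r ℓ} (R : CommutativeRing r ℓ) where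

    open CommutativeRing R hiding (zero)
    open import Algebra.Properties.Semiring.Sum semiring
    open import Algebra.Properties.Ring ring using (-‿distribˡ-*; -0#≈0#; -‿involutive)
    open import Relation.Binary.Reasoning.Setoid setoid
    open import Algebra.Solver.Ring.NaturalCoefficients.Default commutativeSemiring
      using (solve; _:=_; _:+_; _:*_)

    Mat : ℕ → Set r
    Mat n = Fin n → Fin n → Carrier

    sgn : ℕ → Carrier
    sgn zero    = 1#
    sgn (suc k) = - sgn k

    minor : ∀ {n} → Mat (suc n) → Fin (suc n) → Mat n
    minor A j i k = A (suc i) (punchIn j k)

    det : ∀ {n} → Mat n → Carrier
    det {zero}  A = 1#
    det {suc n} A = sum (λ j → sgn (toℕ j) * (A zero j * det (minor A j)))

    sum-zero : ∀ {n} {f : Fin n → Carrier} → (∀ i → f i ≈ 0#) → sum f ≈ 0#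
    sum-zero {n} f≈0 = trans (sum-cong-≋ f≈0) (sum-replicate-zero n)

    det-cong : ∀ {n} {A B : Mat n} → (∀ i j → A i j ≈ B i j) → det A ≈ det B
    det-cong {zero}  A≈B = refl
    det-cong {suc n} A≈B = sum-cong-≋ λ j →
      *-congˡ {sgn (toℕ j)} (*-cong (A≈B zero j) (det-cong λ i k → A≈B (suc i) (punchIn j k)))

    -- Stated for three matrices that agree off column c, not for column updates: this form survives
    -- the passage to a minor, where column c only gets a new index.
    det-linear : ∀ {n} (c : Fin n) a b {A B D : Mat n} →
      (∀ i → D i c ≈ a * A i c + b * B i c) →
      (∀ i j → j ≢ c → D i j ≈ A i j) → (∀ i j → j ≢ c → D i j ≈ B i j) →
      det D ≈ a * det A + b * det B
    det-linear {suc n} c a b {A} {B} {D} Dc D≈A D≈B = begin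
      det D
        ≈⟨ sum-cong-≋ term ⟩
      sum (λ j → a * tA j + b * tB j)
        ≈⟨ ∑-distrib-+ (λ j → a * tA j) (λ j → b * tB j) ⟩
      sum (λ j → a * tA j) + sum (λ j → b * tB j)
        ≈⟨ +-cong (*-distribˡ-sum a tA) (*-distribˡ-sum b tB) ⟨
      a * det A + b * det B ∎
      where
      tA tB tD : Fin (suc n) → Carrier
      tA j = sgn (toℕ j) * (A zero j * det (minor A j))
      tB j = sgn (toℕ j) * (B zero j * det (minor B j))
      tD j = sgn (toℕ j) * (D zero j * det (minor D j))
      term : ∀ j → tD j ≈ a * tA j + b * tB j
      term j with j ≟ c
      ... | yes ≡.refl = begin
        s * (D zero j * dD)                           ≈⟨ *-congˡ (*-congʳ (Dc zero)) ⟩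
        s * ((a * A zero j + b * B zero j) * dD)
          ≈⟨ solve 6 (λ s a x b y d → s :* ((a :* x :+ b :* y) :* d) := a :* (s :* (x :* d)) :+ b :* (s :* (y :* d)))
               refl s a (A zero j) b (B zero j) dD ⟩
        a * (s * (A zero j * dD)) + b * (s * (B zero j * dD))
          ≈⟨ +-cong (*-congˡ (*-congˡ (*-congˡ (det-cong λ i k → D≈A (suc i) _ (punchInᵢ≢i j k)))))
                    (*-congˡ (*-congˡ (*-congˡ (det-cong λ i k → D≈B (suc i) _ (punchInᵢ≢i j k))))) ⟩
        a * tA j + b * tB j ∎
        where s = sgn (toℕ j); dD = det (minor D j)
      ... | no j≢c = begin
        s * (D zero j * det (minor D j))
          ≈⟨ *-congˡ (*-congˡ (det-linear c′ a b
               (λ i → at-c (λ k → D (suc i) k ≈ a * A (suc i) k + b * B (suc i) k) (Dc (suc i)))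
               (λ i k k≢ → D≈A (suc i) _ (off-c k k≢))
               (λ i k k≢ → D≈B (suc i) _ (off-c k k≢)))) ⟩
        s * (D zero j * (a * det (minor A j) + b * det (minor B j)))
          ≈⟨ solve 6 (λ s z a x b y → s :* (z :* (a :* x :+ b :* y)) := a :* (s :* (z :* x)) :+ b :* (s :* (z :* y)))
               refl s (D zero j) a (det (minor A j)) b (det (minor B j)) ⟩
        a * (s * (D zero j * det (minor A j))) + b * (s * (D zero j * det (minor B j)))
          ≈⟨ +-cong (*-congˡ (*-congˡ (*-congʳ (D≈A zero j j≢c))))
                    (*-congˡ (*-congˡ (*-congʳ (D≈B zero j j≢c)))) ⟩
        a * tA j + b * tB j ∎
        where
        s = sgn (toℕ j)
        c′ = punchOut j≢c
        at-c : ∀ {p} (P : Fin (suc n) → Set p) → P c → P (punchIn j c′)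
        at-c P = ≡.subst P (≡.sym (punchIn-punchOut j≢c))
        off-c : ∀ k → k ≢ c′ → punchIn j k ≢ c
        off-c k k≢c′ eq = k≢c′ (punchIn-injective j k c′ (≡.trans eq (≡.sym (punchIn-punchOut j≢c))))

    sum-adjacent : ∀ {n} {c d : Fin n} (f : Fin n → Carrier) → Adjacent c d →
      (∀ j → j ≢ c → j ≢ d → f j ≈ 0#) → sum f ≈ f c + f d
    sum-adjacent f here f≈0 =
      trans (sym (+-assoc _ _ _)) (trans (+-congˡ (sum-zero λ j → f≈0 (suc (suc j)) (λ ()) (λ ()))) (+-identityʳ _))
    sum-adjacent f (there a) f≈0 =
      trans (+-cong (f≈0 zero (λ ()) (λ ()))
                    (sum-adjacent (f ∘ suc) a (λ j p q → f≈0 (suc j) (p ∘ suc-injective) (q ∘ suc-injective))))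
            (+-identityˡ _)

    sgn-adjacent : ∀ {n} {c d : Fin n} → Adjacent c d → sgn (toℕ d) ≈ - sgn (toℕ c)
    sgn-adjacent here = refl
    sgn-adjacent (there a) = -‿cong (sgn-adjacent a)

    -- In the expansion, every term that deletes a third column vanishes by induction, and the terms
    -- deleting c and d have equal minors and opposite signs.
    det-adjacent : ∀ {n} {c d : Fin n} → Adjacent c d → (A : Mat n) →
      (∀ i → A i c ≈ A i d) → det A ≈ 0#
    det-adjacent {suc n} {c} {d} a A Ac≈Ad = begin
      det A                                              ≈⟨ sum-adjacent t a other ⟩
      t c + t d                                          ≈⟨ +-congˡ (*-cong (sgn-adjacent a) (*-cong (sym (Ac≈Ad zero)) (det-cong minors))) ⟩
      s * (A zero c * m) + (- s) * (A zero c * m)        ≈⟨ +-congˡ (-‿distribˡ-* s _) ⟨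
      s * (A zero c * m) + - (s * (A zero c * m))        ≈⟨ -‿inverseʳ _ ⟩
      0#                                                 ∎
      where
      t : Fin (suc n) → Carrier
      t j = sgn (toℕ j) * (A zero j * det (minor A j))
      s = sgn (toℕ c)
      m = det (minor A c)
      other : ∀ j → j ≢ c → j ≢ d → t j ≈ 0#
      other j j≢c j≢d with punchIn-adjacent j j≢c j≢d a
      ... | c′ , d′ , ≡.refl , ≡.refl , a′ =
        trans (*-congˡ (trans (*-congˡ (det-adjacent a′ (minor A j) (λ i → Ac≈Ad (suc i)))) (zeroʳ _))) (zeroʳ _)
      minors : ∀ i k → minor A d i k ≈ minor A c i k
      minors i k with punchIn-of-adjacent a k
      ... | inj₁ p = reflexive (≡.cong (A (suc i)) (≡.sym p))
      ... | inj₂ (p , q) = trans (reflexive (≡.cong (A (suc i)) q))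
                                 (trans (Ac≈Ad (suc i)) (reflexive (≡.cong (A (suc i)) (≡.sym p))))

    infixl 8 _[_]≔_
    _[_]≔_ : ∀ {n} → Mat n → Fin n → (Fin n → Carrier) → Mat n
    (A [ c ]≔ v) i = updateAt (A i) c (const (v i))

    []≔-at : ∀ {n} (A : Mat n) c v i → (A [ c ]≔ v) i c ≈ v i
    []≔-at A c v i = reflexive (updateAt-updates c (A i))

    []≔-off : ∀ {n} (A : Mat n) {c j} v i → j ≢ c → (A [ c ]≔ v) i j ≈ A i j
    []≔-off A {c} {j} v i j≢c = reflexive (updateAt-minimal j c (A i) j≢c)

    det-+ : ∀ {n} (A : Mat n) c {u v w} → (∀ i → w i ≈ u i + v i) →
      det (A [ c ]≔ w) ≈ det (A [ c ]≔ u) + det (A [ c ]≔ v)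
    det-+ A c {u} {v} {w} w≈ = trans
      (det-linear c 1# 1#
        (λ i → trans ([]≔-at A c w i) (trans (w≈ i)
                 (+-cong (trans (sym ([]≔-at A c u i)) (sym (*-identityˡ _)))
                         (trans (sym ([]≔-at A c v i)) (sym (*-identityˡ _))))))
        (λ i j j≢c → trans ([]≔-off A w i j≢c) (sym ([]≔-off A u i j≢c)))
        (λ i j j≢c → trans ([]≔-off A w i j≢c) (sym ([]≔-off A v i j≢c))))
      (+-cong (*-identityˡ _) (*-identityˡ _))

    det-zero : ∀ {n} (A : Mat n) c {v} → (∀ i → v i ≈ 0#) → det (A [ c ]≔ v) ≈ 0#
    det-zero A c {v} v≈0 = trans
      (det-linear c 0# 0# {A} {A}
        (λ i → trans ([]≔-at A c v i) (trans (v≈0 i) (sym (trans (+-cong (zeroˡ _) (zeroˡ _)) (+-identityˡ _)))))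
        (λ i j j≢c → []≔-off A v i j≢c) (λ i j j≢c → []≔-off A v i j≢c))
      (trans (+-cong (zeroˡ _) (zeroˡ _)) (+-identityˡ _))

    det-scale : ∀ {n} (A : Mat n) c a {v w} → (∀ i → w i ≈ a * v i) →
      det (A [ c ]≔ w) ≈ a * det (A [ c ]≔ v)
    det-scale A c a {v} {w} w≈ = trans
      (det-linear c a 0#
        (λ i → trans ([]≔-at A c w i) (trans (w≈ i)
                 (trans (*-congˡ (sym ([]≔-at A c v i))) (sym (trans (+-congˡ (zeroˡ _)) (+-identityʳ _))))))
        (λ i j j≢c → trans ([]≔-off A w i j≢c) (sym ([]≔-off A v i j≢c)))
        (λ i j j≢c → trans ([]≔-off A w i j≢c) (sym ([]≔-off A v i j≢c))))
      (trans (+-congˡ (zeroˡ _)) (+-identityʳ _))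

    det-sum : ∀ {n m} (A : Mat n) c (a : Fin m → Carrier) (v : Fin m → Fin n → Carrier) →
      det (A [ c ]≔ (λ i → sum (λ k → a k * v k i))) ≈ sum (λ k → a k * det (A [ c ]≔ v k))
    det-sum {m = zero}  A c a v = det-zero A c (λ _ → refl)
    det-sum {m = suc m} A c a v =
      trans (det-+ A c (λ _ → refl))
            (+-cong (det-scale A c (a zero) (λ _ → refl)) (det-sum A c (a ∘ suc) (v ∘ suc)))

    det-columns : ∀ {n} {c d : Fin n} (A : Mat n) u v → c ≢ d →
      ∀ i → (A [ c ]≔ u [ d ]≔ v) i c ≈ u i
    det-columns {c = c} A u v c≢d i = trans ([]≔-off (A [ c ]≔ u) v i c≢d) ([]≔-at A c u i)

    -- Polarisation: put u + v in both columns and expand; the three determinants with two equal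
    -- adjacent columns vanish.
    det-swap : ∀ {n} {c d : Fin n} → Adjacent c d → (A : Mat n) (u v : Fin n → Carrier) →
      det (A [ c ]≔ u [ d ]≔ v) + det (A [ c ]≔ v [ d ]≔ u) ≈ 0#
    det-swap {n} {c} {d} a A u v = begin
      D u v + D v u                          ≈⟨ +-cong (+-identityˡ _) (+-identityʳ _) ⟨
      (0# + D u v) + (D v u + 0#)            ≈⟨ +-cong (+-congʳ (equal u)) (+-congˡ (equal v)) ⟨
      (D u u + D u v) + (D v u + D v v)      ≈⟨ +-cong (second u) (second v) ⟨
      D u w + D v w                          ≈⟨ first ⟨
      D w w                                  ≈⟨ equal w ⟩
      0#                                     ∎
      where
      c≢d = adjacent⇒≢ a
      w : Fin n → Carrier
      w i = u i + v i
      D : (Fin n → Carrier) → (Fin n → Carrier) → Carrier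
      D p q = det (A [ c ]≔ p [ d ]≔ q)
      equal : ∀ p → D p p ≈ 0#
      equal p = det-adjacent a _ λ i →
        trans (det-columns A p p c≢d i) (sym ([]≔-at (A [ c ]≔ p) d p i))
      second : ∀ p → D p w ≈ D p u + D p v
      second p = det-+ (A [ c ]≔ p) d (λ _ → refl)
      off : ∀ p i j → j ≢ c → (A [ c ]≔ w [ d ]≔ w) i j ≈ (A [ c ]≔ p [ d ]≔ w) i j
      off p i j j≢c with j ≟ d
      ... | yes ≡.refl = trans ([]≔-at (A [ c ]≔ w) d w i) (sym ([]≔-at (A [ c ]≔ p) d w i))
      ... | no j≢d = trans ([]≔-off (A [ c ]≔ w) w i j≢d) (trans ([]≔-off A w i j≢c)
                     (sym (trans ([]≔-off (A [ c ]≔ p) w i j≢d) ([]≔-off A p i j≢c))))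
      first : D w w ≈ D u w + D v w
      first = trans
        (det-linear c 1# 1#
          (λ i → trans (det-columns A w w c≢d i)
                   (+-cong (trans (sym (det-columns A u w c≢d i)) (sym (*-identityˡ _)))
                           (trans (sym (det-columns A v w c≢d i)) (sym (*-identityˡ _)))))
          (off u) (off v))
        (+-cong (*-identityˡ _) (*-identityˡ _))

    []≔-id : ∀ {n} (A : Mat n) c i j → (A [ c ]≔ (λ k → A k c)) i j ≈ A i j
    []≔-id A c i j with j ≟ c
    ... | yes ≡.refl = []≔-at A c (λ k → A k c) i
    ... | no j≢c = []≔-off A (λ k → A k c) i j≢c

    -- Swapping e with its neighbour d brings the copy of column c one step nearer along the chain
    -- and changes only the sign.
    det-alternating-≺ : ∀ {n} {c d : Fin n} → c ≺ d → (A : Mat n) →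
      (∀ i → A i c ≈ A i d) → det A ≈ 0#
    det-alternating-≺ (step a) A Ac≈Ad = det-adjacent a A Ac≈Ad
    det-alternating-≺ {n} {c} (_▸_ {d} {e} c≺d a) A Ac≈Ae = begin
      det A                                      ≈⟨ det-cong unchanged ⟨
      det (A [ d ]≔ col d [ e ]≔ col e)          ≈⟨ +-identityʳ _ ⟨
      det (A [ d ]≔ col d [ e ]≔ col e) + 0#     ≈⟨ +-congˡ (det-alternating-≺ c≺d A′ A′c≈A′d) ⟨
      det (A [ d ]≔ col d [ e ]≔ col e) + det A′ ≈⟨ det-swap a A (col d) (col e) ⟩
      0#                                         ∎
      where
      col : Fin n → Fin n → Carrier
      col j i = A i j
      A′ : Mat n
      A′ = A [ d ]≔ col e [ e ]≔ col d
      c≢d = ≺⇒≢ c≺d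
      c≢e = ≺⇒≢ (c≺d ▸ a)
      unchanged : ∀ i j → (A [ d ]≔ col d [ e ]≔ col e) i j ≈ A i j
      unchanged i j with j ≟ e
      ... | yes ≡.refl = []≔-at (A [ d ]≔ col d) e (col e) i
      ... | no j≢e = trans ([]≔-off (A [ d ]≔ col d) (col e) i j≢e) ([]≔-id A d i j)
      A′c≈A′d : ∀ i → A′ i c ≈ A′ i d
      A′c≈A′d i = trans
        (trans ([]≔-off (A [ d ]≔ col e) (col d) i c≢e) (trans ([]≔-off A (col e) i c≢d) (Ac≈Ae i)))
        (sym (det-columns A (col e) (col d) (adjacent⇒≢ a) i))

    det-alternating : ∀ {n} {c d : Fin n} → c ≢ d → (A : Mat n) →
      (∀ i → A i c ≈ A i d) → det A ≈ 0#
    det-alternating {c = c} {d} c≢d A Ac≈Ad with ≺-total c d c≢d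
    ... | inj₁ c≺d = det-alternating-≺ c≺d A Ac≈Ad
    ... | inj₂ d≺c = det-alternating-≺ d≺c A (sym ∘ Ac≈Ad)

    δ : ∀ {n} → Fin n → Fin n → Carrier
    δ i j = if does (i ≟ j) then 1# else 0#

    sum-δ : ∀ {n} (f : Fin n → Carrier) i → sum (λ k → f k * δ k i) ≈ f i
    sum-δ {suc n} f zero = trans (+-cong (*-identityʳ _) (sum-zero (λ k → zeroʳ (f (suc k))))) (+-identityʳ _)
    sum-δ {suc n} f (suc i) = trans (+-cong (zeroʳ _) (sum-δ (f ∘ suc) i)) (+-identityˡ _)

    -- Cofactors in Cramer's form: column c is replaced by a basis vector. Multilinearity and
    -- alternation then give `adjugate-mul` without any cofactor signs.
    adjugate : ∀ {n} → Mat n → Mat n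
    adjugate A c i = det (A [ c ]≔ (λ k → δ i k))

    adjugate-column : ∀ {n} (A : Mat n) c (v : Fin n → Carrier) →
      sum (λ i → v i * adjugate A c i) ≈ det (A [ c ]≔ v)
    adjugate-column A c v = trans (sym (det-sum A c v δ)) (det-cong entry)
      where
      w : Fin _ → Carrier
      w i = sum (λ k → v k * δ k i)
      expand : ∀ i → w i ≈ v i
      expand = sum-δ v
      entry : ∀ i j → (A [ c ]≔ w) i j ≈ (A [ c ]≔ v) i j
      entry i j with j ≟ c
      ... | yes ≡.refl = trans ([]≔-at A c w i) (trans (expand i) (sym ([]≔-at A c v i)))
      ... | no j≢c = trans ([]≔-off A w i j≢c) (sym ([]≔-off A v i j≢c))

    adjugate-mul : ∀ {n} (A : Mat n) c j →
      sum (λ i → A i j * adjugate A c i) ≈ δ c j * det A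
    adjugate-mul A c j with c ≟ j
    ... | yes ≡.refl = trans (adjugate-column A c (λ i → A i c))
                             (trans (det-cong ([]≔-id A c)) (sym (*-identityˡ _)))
    ... | no c≢j = trans (adjugate-column A c (λ i → A i j))
                         (trans (det-alternating c≢j _ λ i →
                                   trans ([]≔-at A c (col j) i) (sym ([]≔-off A (col j) i (c≢j ∘ ≡.sym))))
                                (sym (zeroˡ _)))
      where
      col : Fin _ → Fin _ → Carrier
      col k i = A i k

    -- The first-row expansion is enough: every minor that keeps the last column again has zeros
    -- above its corner, so the corner factors out by induction.
    det-last-column : ∀ {n} (A : Mat (suc n)) → (∀ i → A (inject₁ i) (fromℕ n) ≈ 0#) →
      det A ≈ A (fromℕ n) (fromℕ n) * det (λ i j → A (inject₁ i) (inject₁ j))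
    det-last-column {zero} A _ =
      trans (+-identityʳ _) (*-identityˡ _)
    det-last-column {suc n} A last≈0 = begin
      det A                                       ≈⟨ sum-init-last t ⟩
      sum (t ∘ inject₁) + t (fromℕ (suc n))       ≈⟨ +-cong (sum-cong-≋ term)
                                                       (trans (*-congˡ (trans (*-congʳ (last≈0 zero)) (zeroˡ _))) (zeroʳ _)) ⟩
      sum (λ j → corner * t′ j) + 0#              ≈⟨ +-identityʳ _ ⟩
      sum (λ j → corner * t′ j)                   ≈⟨ *-distribˡ-sum corner t′ ⟨
      corner * det A′                             ∎
      where
      t : Fin (suc (suc n)) → Carrier
      t j = sgn (toℕ j) * (A zero j * det (minor A j))
      A′ : Mat (suc n)
      A′ i j = A (inject₁ i) (inject₁ j)
      t′ : Fin (suc n) → Carrier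
      t′ j = sgn (toℕ j) * (A′ zero j * det (minor A′ j))
      corner = A (fromℕ (suc n)) (fromℕ (suc n))
      term : ∀ j → t (inject₁ j) ≈ corner * t′ j
      term j = begin
        sgn (toℕ (inject₁ j)) * (A′ zero j * det (minor A (inject₁ j)))
          ≈⟨ *-cong (reflexive (≡.cong sgn (toℕ-inject₁ j))) (*-congˡ (trans
               (det-last-column (minor A (inject₁ j)) λ i →
                 trans (reflexive (≡.cong (A (suc (inject₁ i))) (punchIn-inject₁-fromℕ j))) (last≈0 (suc i)))
               (*-cong (reflexive (≡.cong (A (fromℕ (suc n))) (punchIn-inject₁-fromℕ j)))
                       (det-cong λ i k → reflexive (≡.cong (A (suc (inject₁ i))) (punchIn-inject₁ j k)))))) ⟩
        sgn (toℕ j) * (A′ zero j * (corner * det (minor A′ j)))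
          ≈⟨ solve 4 (λ s x c m → s :* (x :* (c :* m)) := c :* (s :* (x :* m)))
               refl (sgn (toℕ j)) (A′ zero j) corner (det (minor A′ j)) ⟩
        corner * t′ j ∎

    -- A Schur complement without division: q times the last column plus the p-combination of the
    -- others has zeros above the corner. Scaling by q costs a factor q, and the added columns
    -- contribute repeated columns.
    det-clear-last-column : ∀ {n} (A : Mat (suc n)) q (p : Fin n → Carrier) →
      (∀ i → q * A (inject₁ i) (fromℕ n) + sum (λ j → p j * A (inject₁ i) (inject₁ j)) ≈ 0#) →
      q * det A ≈ (q * A (fromℕ n) (fromℕ n) + sum (λ j → p j * A (fromℕ n) (inject₁ j)))
                  * det (λ i j → A (inject₁ i) (inject₁ j))
    det-clear-last-column {n} A q p cleared = begin
      q * det A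
        ≈⟨ +-identityʳ _ ⟨
      q * det A + 0#
        ≈⟨ +-cong (trans (det-scale A z q {col z} (λ _ → refl)) (*-congˡ (det-cong ([]≔-id A z))))
                  (trans (det-sum A z p v) (sum-zero λ j → trans (*-congˡ (repeated j)) (zeroʳ _))) ⟨
      det (A [ z ]≔ (λ i → q * col z i)) + det (A [ z ]≔ (λ i → sum (λ j → p j * v j i)))
        ≈⟨ det-+ A z {λ i → q * col z i} {λ i → sum (λ j → p j * v j i)} {w} (λ _ → refl) ⟨
      det A′
        ≈⟨ det-last-column A′ (λ i → trans ([]≔-at A z w (inject₁ i)) (cleared i)) ⟩
      A′ z z * det (λ i j → A′ (inject₁ i) (inject₁ j))
        ≈⟨ *-cong ([]≔-at A z w z) (det-cong λ i j → []≔-off A w (inject₁ i) (fromℕ≢inject₁ ∘ ≡.sym)) ⟩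
      w z * det (λ i j → A (inject₁ i) (inject₁ j)) ∎
      where
      z = fromℕ n
      col : Fin (suc n) → Fin (suc n) → Carrier
      col j i = A i j
      v : Fin n → Fin (suc n) → Carrier
      v j i = A i (inject₁ j)
      w : Fin (suc n) → Carrier
      w i = q * A i z + sum (λ j → p j * v j i)
      A′ : Mat (suc n)
      A′ = A [ z ]≔ w
      repeated : ∀ j → det (A [ z ]≔ v j) ≈ 0#
      repeated j = det-alternating (fromℕ≢inject₁ {i = j}) (A [ z ]≔ v j) λ i →
        trans ([]≔-at A z (v j) i) (sym ([]≔-off A (v j) i (fromℕ≢inject₁ ∘ ≡.sym)))

-- The ring of integer polynomials and its cancellation laws

module Polynomials where

  open import Defs
  open Determinants
  open import Algebra.Bundles using (CommutativeRing)
  open import Data.Bool using (if_then_else_; true; false)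
  open import Data.Fin using (Fin; zero; suc; toℕ; punchIn; _≟_)
  open import Data.Integer as ℤ using (ℤ; +_; -_; _+_; _*_; 0ℤ; 1ℤ)
  import Data.Integer.Properties as ℤ
  open import Data.Integer.Tactic.RingSolver using (solve-∀)
  open import Data.List using ([]; _∷_)
  open import Data.Maybe using (Maybe; just; nothing)
  open import Data.Nat as ℕ using (ℕ; zero; suc)
  open import Data.Product using (_,_)
  open import Function using (_∘_)
  open import Level using (0ℓ)
  open import Relation.Binary using (IsEquivalence)
  open import Relation.Binary.PropositionalEquality as ≡ using (_≡_; refl; cong; cong₂)
  open import Relation.Nullary using (does)
  open import Tactic.RingSolver.Core.AlmostCommutativeRing using (AlmostCommutativeRing; fromCommutativeRing)
  open import Algebra.Properties.AbelianGroup ℤ.+-0-abelianGroup using (∙-cancelˡ)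

  -- A record around _≈P_, so that both polynomials can be inferred from a proof of equality.
  infix 4 _≋_
  record _≋_ (p q : Poly) : Set where
    constructor coeffs
    field at : p ≈P q
  open _≋_ public

  negP : Poly → Poly
  negP = Data.List.map (-_)

  coeff-+P : ∀ p q k → coeff (p +P q) k ≡ coeff p k + coeff q k
  coeff-+P []      q       k       = ≡.sym (ℤ.+-identityˡ _)
  coeff-+P (a ∷ p) []      k       = ≡.sym (ℤ.+-identityʳ _)
  coeff-+P (a ∷ p) (b ∷ q) zero    = refl
  coeff-+P (a ∷ p) (b ∷ q) (suc k) = coeff-+P p q k

  coeff-negP : ∀ p k → coeff (negP p) k ≡ - coeff p k
  coeff-negP []      k       = refl
  coeff-negP (a ∷ p) zero    = refl
  coeff-negP (a ∷ p) (suc k) = coeff-negP p k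

  coeff-scale : ∀ a p k → coeff (scale a p) k ≡ a * coeff p k
  coeff-scale a []      k       = ≡.sym (ℤ.*-zeroʳ a)
  coeff-scale a (b ∷ p) zero    = refl
  coeff-scale a (b ∷ p) (suc k) = coeff-scale a p k

  ≋-isEquivalence : IsEquivalence _≋_
  ≋-isEquivalence = record
    { refl  = coeffs λ _ → refl
    ; sym   = λ p≋q → coeffs λ k → ≡.sym (at p≋q k)
    ; trans = λ p≋q q≋r → coeffs λ k → ≡.trans (at p≋q k) (at q≋r k)
    }

  open IsEquivalence ≋-isEquivalence public using () renaming (refl to ≋-refl; sym to ≋-sym; trans to ≋-trans)

  coeff-∷*P : ∀ a p q k → coeff ((a ∷ p) *P q) k ≡ a * coeff q k + coeff (0ℤ ∷ (p *P q)) k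
  coeff-∷*P a p q k = ≡.trans (coeff-+P (scale a q) _ k) (cong (_+ coeff (0ℤ ∷ (p *P q)) k) (coeff-scale a q k))

  ∷-cong : ∀ {a b p q} → a ≡ b → p ≋ q → (a ∷ p) ≋ (b ∷ q)
  ∷-cong a≡b p≋q = coeffs λ { zero → a≡b ; (suc k) → at p≋q k }

  +P-cong : ∀ {p p′ q q′} → p ≋ p′ → q ≋ q′ → (p +P q) ≋ (p′ +P q′)
  +P-cong {p} {p′} {q} {q′} e f = coeffs λ k →
    ≡.trans (coeff-+P p q k) (≡.trans (cong₂ _+_ (at e k) (at f k)) (≡.sym (coeff-+P p′ q′ k)))

  *P-congˡ : ∀ p {q q′} → q ≋ q′ → (p *P q) ≋ (p *P q′)
  *P-congˡ []      e = ≋-refl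
  *P-congˡ (a ∷ p) {q} {q′} e = coeffs λ k → ≡.trans (coeff-∷*P a p q k)
    (≡.trans (cong₂ _+_ (cong (a *_) (at e k)) (at (∷-cong refl (*P-congˡ p e)) k)) (≡.sym (coeff-∷*P a p q′ k)))

  *P-[] : ∀ p → (p *P []) ≋ []
  *P-[] []      = ≋-refl
  *P-[] (a ∷ p) = coeffs λ { zero → refl ; (suc k) → at (*P-[] p) k }

  -- Mirror image of the defining clause of `_*P_`, recursing on the second factor; commutativity
  -- follows from the two by induction.
  *P-∷ : ∀ p b q → (p *P (b ∷ q)) ≋ (scale b p +P (0ℤ ∷ (p *P q)))
  *P-∷ []      b q = coeffs λ { zero → refl ; (suc k) → refl }
  *P-∷ (a ∷ p) b q = ∷-cong (cong (_+ 0ℤ) (ℤ.*-comm a b)) (coeffs tail)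
    where
    open ≡.≡-Reasoning
    tail : (scale a q +P (p *P (b ∷ q))) ≈P (scale b p +P ((a ∷ p) *P q))
    tail k = begin
      coeff (scale a q +P (p *P (b ∷ q))) k
        ≡⟨ coeff-+P (scale a q) _ k ⟩
      coeff (scale a q) k + coeff (p *P (b ∷ q)) k
        ≡⟨ cong₂ _+_ (coeff-scale a q k) (≡.trans (at (*P-∷ p b q) k) (coeff-+P (scale b p) _ k)) ⟩
      a * coeff q k + (coeff (scale b p) k + coeff (0ℤ ∷ (p *P q)) k)
        ≡⟨ swap (a * coeff q k) (coeff (scale b p) k) (coeff (0ℤ ∷ (p *P q)) k) ⟩
      coeff (scale b p) k + (a * coeff q k + coeff (0ℤ ∷ (p *P q)) k)
        ≡⟨ cong (_+_ (coeff (scale b p) k)) (coeff-∷*P a p q k) ⟨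
      coeff (scale b p) k + coeff ((a ∷ p) *P q) k
        ≡⟨ coeff-+P (scale b p) _ k ⟨
      coeff (scale b p +P ((a ∷ p) *P q)) k ∎
      where
      swap : ∀ x y z → x + (y + z) ≡ y + (x + z)
      swap = solve-∀

  *P-comm : ∀ p q → (p *P q) ≋ (q *P p)
  *P-comm []      q = ≋-sym (*P-[] q)
  *P-comm (a ∷ p) q =
    ≋-trans (+P-cong {scale a q} ≋-refl (∷-cong refl (*P-comm p q))) (≋-sym (*P-∷ q a p))

  *P-cong : ∀ {p p′ q q′} → p ≋ p′ → q ≋ q′ → (p *P q) ≋ (p′ *P q′)
  *P-cong {p} {p′} {q} {q′} e f =
    ≋-trans (*P-congˡ p f) (≋-trans (*P-comm p q′) (≋-trans (*P-congˡ q′ e) (*P-comm q′ p′)))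

  *P-distribˡ : ∀ p q r → (p *P (q +P r)) ≋ (p *P q +P p *P r)
  *P-distribˡ []      q r = ≋-refl
  *P-distribˡ (a ∷ p) q r = coeffs λ k → begin
    coeff ((a ∷ p) *P (q +P r)) k
      ≡⟨ coeff-∷*P a p (q +P r) k ⟩
    a * coeff (q +P r) k + coeff (0ℤ ∷ (p *P (q +P r))) k
      ≡⟨ cong₂ (λ u v → a * u + v) (coeff-+P q r k)
           (≡.trans (at (∷-cong refl (*P-distribˡ p q r)) k) (coeff-+P (0ℤ ∷ (p *P q)) (0ℤ ∷ (p *P r)) k)) ⟩
    a * (coeff q k + coeff r k) + (coeff (0ℤ ∷ (p *P q)) k + coeff (0ℤ ∷ (p *P r)) k)
      ≡⟨ regroup a _ _ _ _ ⟩
    (a * coeff q k + coeff (0ℤ ∷ (p *P q)) k) + (a * coeff r k + coeff (0ℤ ∷ (p *P r)) k)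
      ≡⟨ cong₂ _+_ (coeff-∷*P a p q k) (coeff-∷*P a p r k) ⟨
    coeff ((a ∷ p) *P q) k + coeff ((a ∷ p) *P r) k
      ≡⟨ coeff-+P ((a ∷ p) *P q) _ k ⟨
    coeff ((a ∷ p) *P q +P (a ∷ p) *P r) k ∎
    where
    open ≡.≡-Reasoning
    regroup : ∀ a x y u v → a * (x + y) + (u + v) ≡ (a * x + u) + (a * y + v)
    regroup = solve-∀

  *P-distribʳ : ∀ p q r → ((q +P r) *P p) ≋ (q *P p +P r *P p)
  *P-distribʳ p q r = ≋-trans (*P-comm (q +P r) p) (≋-trans (*P-distribˡ p q r) (+P-cong (*P-comm p q) (*P-comm p r)))

  scale-*P : ∀ a p q → (scale a p *P q) ≋ scale a (p *P q)
  scale-*P a []      q = ≋-refl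
  scale-*P a (b ∷ p) q = coeffs λ k → begin
    coeff (scale a (b ∷ p) *P q) k
      ≡⟨ coeff-∷*P (a * b) (scale a p) q k ⟩
    (a * b) * coeff q k + coeff (0ℤ ∷ (scale a p *P q)) k
      ≡⟨ cong (_+_ ((a * b) * coeff q k)) (≡.trans (at (∷-cong (≡.sym (ℤ.*-zeroʳ a)) (scale-*P a p q)) k) (coeff-scale a (0ℤ ∷ (p *P q)) k)) ⟩
    (a * b) * coeff q k + a * coeff (0ℤ ∷ (p *P q)) k
      ≡⟨ factor a b _ _ ⟩
    a * (b * coeff q k + coeff (0ℤ ∷ (p *P q)) k)
      ≡⟨ cong (a *_) (coeff-∷*P b p q k) ⟨
    a * coeff ((b ∷ p) *P q) k
      ≡⟨ coeff-scale a ((b ∷ p) *P q) k ⟨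
    coeff (scale a ((b ∷ p) *P q)) k ∎
    where
    open ≡.≡-Reasoning
    factor : ∀ a b x y → (a * b) * x + a * y ≡ a * (b * x + y)
    factor = solve-∀

  0∷-*P : ∀ p q → ((0ℤ ∷ p) *P q) ≋ (0ℤ ∷ (p *P q))
  0∷-*P p q = coeffs λ k → ≡.trans (coeff-∷*P 0ℤ p q k) (ℤ.+-identityˡ _)

  *P-assoc : ∀ p q r → ((p *P q) *P r) ≋ (p *P (q *P r))
  *P-assoc []      q r = ≋-refl
  *P-assoc (a ∷ p) q r = ≋-trans (*P-distribʳ r (scale a q) (0ℤ ∷ (p *P q)))
    (+P-cong (scale-*P a q r) (≋-trans (0∷-*P (p *P q) r) (∷-cong refl (*P-assoc p q r))))

  *P-identityˡ : ∀ p → (C 1ℤ *P p) ≋ p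
  *P-identityˡ p = coeffs λ k → ≡.trans (coeff-∷*P 1ℤ [] p k)
    (≡.trans (cong₂ _+_ (ℤ.*-identityˡ (coeff p k)) (zeros k)) (ℤ.+-identityʳ _))
    where
    zeros : ∀ k → coeff (0ℤ ∷ []) k ≡ 0ℤ
    zeros zero    = refl
    zeros (suc k) = refl

  polyRing : CommutativeRing 0ℓ 0ℓ
  polyRing = record
    { Carrier = Poly ; _≈_ = _≋_ ; _+_ = _+P_ ; _*_ = _*P_ ; -_ = negP ; 0# = [] ; 1# = C 1ℤ
    ; isCommutativeRing = record
      { isRing = record
        { +-isAbelianGroup = record
          { isGroup = record
            { isMonoid = record
              { isSemigroup = record
                { isMagma = record { isEquivalence = ≋-isEquivalence ; ∙-cong = +P-cong }
                ; assoc = λ p q r → coeffs λ k →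
                    ≡.trans (coeff-+P (p +P q) r k) (≡.trans (cong (_+ coeff r k) (coeff-+P p q k))
                    (≡.trans (ℤ.+-assoc (coeff p k) _ _)
                    (≡.sym (≡.trans (coeff-+P p (q +P r) k) (cong (_+_ (coeff p k)) (coeff-+P q r k)))))) }
              ; identity = (λ p → ≋-refl) , λ p → coeffs λ k → ≡.trans (coeff-+P p [] k) (ℤ.+-identityʳ _) }
            ; inverse =
                (λ p → coeffs λ k → ≡.trans (coeff-+P (negP p) p k)
                         (≡.trans (cong (_+ coeff p k) (coeff-negP p k)) (ℤ.+-inverseˡ (coeff p k))))
              , (λ p → coeffs λ k → ≡.trans (coeff-+P p (negP p) k)
                         (≡.trans (cong (_+_ (coeff p k)) (coeff-negP p k)) (ℤ.+-inverseʳ (coeff p k))))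
            ; ⁻¹-cong = λ {p} {q} e → coeffs λ k →
                ≡.trans (coeff-negP p k) (≡.trans (cong -_ (at e k)) (≡.sym (coeff-negP q k))) }
          ; comm = λ p q → coeffs λ k →
              ≡.trans (coeff-+P p q k) (≡.trans (ℤ.+-comm (coeff p k) _) (≡.sym (coeff-+P q p k))) }
        ; *-cong = *P-cong
        ; *-assoc = *P-assoc
        ; *-identity = *P-identityˡ , λ p → ≋-trans (*P-comm p (C 1ℤ)) (*P-identityˡ p)
        ; distrib = *P-distribˡ , *P-distribʳ }
      ; *-comm = *P-comm } }

  zero? : ∀ p → Maybe ([] ≋ p)
  zero? [] = just ≋-refl
  zero? (+ 0 ∷ p) = Data.Maybe.map (λ e → coeffs λ { zero → refl ; (suc k) → at e k }) (zero? p)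
  zero? _ = nothing

  polyACR : AlmostCommutativeRing 0ℓ 0ℓ
  polyACR = fromCommutativeRing polyRing zero?

  module D = Determinant polyRing
  module ΣP where open import Algebra.Properties.Semiring.Sum (CommutativeRing.semiring polyRing) public

  C-* : ∀ a b → C (a * b) ≋ (C a *P C b)
  C-* a b = ∷-cong (≡.sym (ℤ.+-identityʳ _)) ≋-refl

  C-0 : C 0ℤ ≋ []
  C-0 = coeffs λ { zero → refl ; (suc k) → refl }

  scale-C : ∀ a p → scale a p ≋ (C a *P p)
  scale-C a p = ≋-sym (≋-trans (+P-cong {scale a p} ≋-refl C-0) (CommutativeRing.+-identityʳ polyRing _))

  sumP≡sum : ∀ {n} (f : Fin n → Poly) → sumP f ≡ ΣP.sum f
  sumP≡sum {zero}  f = refl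
  sumP≡sum {suc n} f = cong (f zero +P_) (sumP≡sum (f ∘ suc))

  sgn≡sign : ∀ k → D.sgn k ≡ C (sign k)
  sgn≡sign zero    = refl
  sgn≡sign (suc k) = cong negP (sgn≡sign k)

  det≋det : ∀ {n} (A : Fin n → Fin n → Poly) → det A ≋ D.det A
  det≋det {zero}  A = ≋-refl
  det≋det {suc n} A = ≋-trans
    (CommutativeRing.reflexive polyRing (sumP≡sum term))
    (ΣP.sum-cong-≋ λ j → ≋-trans (scale-C (sign (toℕ j)) _)
      (*P-cong (CommutativeRing.reflexive polyRing (≡.sym (sgn≡sign (toℕ j))))
               (*P-congˡ (A zero j) (det≋det (λ i k → A (suc i) (punchIn j k))))))
    where
    term : Fin (suc n) → Poly
    term j = scale (sign (toℕ j)) (A zero j *P det (λ i k → A (suc i) (punchIn j k)))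

  coeff-X* : ∀ p k → coeff (X *P p) (suc k) ≡ coeff p k
  coeff-X* p k = ≡.trans (at (0∷-*P (C 1ℤ) p) (suc k)) (at (*P-identityˡ p) k)

  coeff-X*-zero : ∀ p → coeff (X *P p) 0 ≡ 0ℤ
  coeff-X*-zero p = at (0∷-*P (C 1ℤ) p) 0

  X*-cancel : ∀ {p q} → (X *P p) ≋ (X *P q) → p ≋ q
  X*-cancel {p} {q} e = coeffs λ k → ≡.trans (≡.sym (coeff-X* p k)) (≡.trans (at e (suc k)) (coeff-X* q k))

  -- Coefficient k of (X² + a) p is p_(k-2) + a p_k, so the product determines the coefficients of p
  -- from the lowest upwards.
  X²+a*-cancel : ∀ a .{{_ : ℤ.NonZero a}} {p q} → ((X *P X +P C a) *P p) ≋ ((X *P X +P C a) *P q) → p ≋ q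
  X²+a*-cancel a {p} {q} e = coeffs λ k → go k
    where
    expand : ∀ p k → coeff ((X *P X +P C a) *P p) k ≡ coeff (X *P (X *P p)) k + a * coeff p k
    expand p k = ≡.trans (at (*P-distribʳ p (X *P X) (C a)) k)
      (≡.trans (coeff-+P (X *P X *P p) (C a *P p) k)
        (cong₂ _+_ (at (*P-assoc X X p) k)
          (≡.trans (≡.sym (at (scale-C a p) k)) (coeff-scale a p k))))
    low : ∀ k → coeff (X *P (X *P p)) k ≡ coeff (X *P (X *P q)) k → coeff p k ≡ coeff q k
    low k same = ℤ.*-cancelˡ-≡ a _ _ (∙-cancelˡ (coeff (X *P (X *P p)) k) _ _
      (≡.trans (≡.sym (expand p k)) (≡.trans (at e k)
        (≡.trans (expand q k) (cong (_+ a * coeff q k) (≡.sym same))))))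
    go : ∀ k → coeff p k ≡ coeff q k
    go zero = low 0 (≡.trans (coeff-X*-zero (X *P p)) (≡.sym (coeff-X*-zero (X *P q))))
    go (suc zero) = low 1 (≡.trans (one p) (≡.sym (one q)))
      where
      one : ∀ p → coeff (X *P (X *P p)) 1 ≡ 0ℤ
      one p = ≡.trans (coeff-X* (X *P p) 0) (coeff-X*-zero p)
    go (suc (suc k)) = low (suc (suc k)) (≡.trans (shift p) (≡.trans (go k) (≡.sym (shift q))))
      where
      shift : ∀ p → coeff (X *P (X *P p)) (suc (suc k)) ≡ coeff p k
      shift p = ≡.trans (coeff-X* (X *P p) (suc k)) (coeff-X* p k)

  -- Polynomials in S acting on integer row vectors, and the Cayley-Hamilton theorem

  module Σℤ where open import Algebra.Properties.Semiring.Sum ℤ.+-*-semiring public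
  open Σℤ using (sum; sum-cong-≗; ∑-distrib-+; ∑-comm; *-distribˡ-sum; *-distribʳ-sum)
  module Dℤ = Determinant ℤ.+-*-commutativeRing

  ℤVec : ℕ → Set
  ℤVec n = Fin n → ℤ

  e : ∀ {n} → Fin n → ℤVec n
  e = Dℤ.δ

  sum-e : ∀ {n} (f : ℤVec n) i → sum (λ k → e i k * f k) ≡ f i
  sum-e {suc n} f zero = ≡.trans (cong₂ _+_ (ℤ.*-identityˡ (f zero)) (Dℤ.sum-zero λ k → ℤ.*-zeroˡ (f (suc k)))) (ℤ.+-identityʳ _)
  sum-e {suc n} f (suc i) = ≡.trans (cong₂ _+_ (ℤ.*-zeroˡ (f zero)) (sum-e (f ∘ suc) i)) (ℤ.+-identityˡ _)

  infixl 7 _⊙_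
  opaque
    _⊙_ : ∀ {n} → ℤVec n → Matrix n → ℤVec n
    (v ⊙ S) j = sum (λ i → v i * S i j)

    ⊙-cong : ∀ {n} {S : Matrix n} {u v} → (∀ i → u i ≡ v i) → ∀ j → (u ⊙ S) j ≡ (v ⊙ S) j
    ⊙-cong u≗v j = sum-cong-≗ λ i → cong (_* _) (u≗v i)

    ⊙-linear : ∀ {n} (S : Matrix n) a b u v j →
      ((λ i → a * u i + b * v i) ⊙ S) j ≡ a * (u ⊙ S) j + b * (v ⊙ S) j
    ⊙-linear S a b u v j = begin
      sum (λ i → (a * u i + b * v i) * S i j)
        ≡⟨ sum-cong-≗ (λ i → rearrange a b (u i) (v i) (S i j)) ⟩
      sum (λ i → a * (u i * S i j) + b * (v i * S i j))
        ≡⟨ ∑-distrib-+ (λ i → a * (u i * S i j)) (λ i → b * (v i * S i j)) ⟩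
      sum (λ i → a * (u i * S i j)) + sum (λ i → b * (v i * S i j))
        ≡⟨ cong₂ _+_ (*-distribˡ-sum a (λ i → u i * S i j)) (*-distribˡ-sum b (λ i → v i * S i j)) ⟨
      a * (u ⊙ S) j + b * (v ⊙ S) j ∎
      where
      open ≡.≡-Reasoning
      rearrange : ∀ a b x y s → (a * x + b * y) * s ≡ a * (x * s) + b * (y * s)
      rearrange = solve-∀

    ⊙-zero : ∀ {n} (S : Matrix n) {v} → (∀ i → v i ≡ 0ℤ) → ∀ j → (v ⊙ S) j ≡ 0ℤ
    ⊙-zero S v≡0 j = Dℤ.sum-zero λ i → cong (_* S i j) (v≡0 i)

    ⊙-+ : ∀ {n} (S : Matrix n) u v j → ((λ i → u i + v i) ⊙ S) j ≡ (u ⊙ S) j + (v ⊙ S) j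
    ⊙-+ S u v j = ≡.trans (sum-cong-≗ λ i → ℤ.*-distribʳ-+ (S i j) (u i) (v i))
                          (∑-distrib-+ (λ i → u i * S i j) (λ i → v i * S i j))

    ⊙-scale : ∀ {n} (S : Matrix n) a v j → ((λ i → a * v i) ⊙ S) j ≡ a * (v ⊙ S) j
    ⊙-scale S a v j = ≡.trans (sum-cong-≗ λ i → ℤ.*-assoc a (v i) (S i j))
                              (≡.sym (*-distribˡ-sum a (λ i → v i * S i j)))

    e-⊙ : ∀ {n} (S : Matrix n) i j → (e i ⊙ S) j ≡ S i j
    e-⊙ S i j = sum-e (λ k → S k j) i

    ⊙-def : ∀ {n} (v : ℤVec n) (S : Matrix n) j → (v ⊙ S) j ≡ sum (λ i → v i * S i j)
    ⊙-def v S j = refl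

  -- The row vector v p(S).
  act : ∀ {n} → Matrix n → Poly → ℤVec n → ℤVec n
  act S []      v i = 0ℤ
  act S (a ∷ p) v i = a * v i + (act S p v ⊙ S) i

  module _ {n} (S : Matrix n) where

    act-≋[] : ∀ {p} → p ≋ [] → ∀ v i → act S p v i ≡ 0ℤ
    act-≋[] {[]}    p≋[] v i = refl
    act-≋[] {a ∷ p} p≋[] v i = cong₂ _+_ (cong (_* v i) (at p≋[] 0))
      (⊙-zero S (act-≋[] {p} (coeffs λ k → at p≋[] (suc k)) v) i)

    act-cong : ∀ {p q} → p ≋ q → ∀ v i → act S p v i ≡ act S q v i
    act-cong {[]} {q} p≋q v i = ≡.sym (act-≋[] (≋-sym p≋q) v i)
    act-cong {a ∷ p} {[]} p≋q v i = act-≋[] p≋q v i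
    act-cong {a ∷ p} {b ∷ q} p≋q v i = cong₂ _+_ (cong (_* v i) (at p≋q 0))
      (⊙-cong {S = S} (act-cong {p} {q} (coeffs λ k → at p≋q (suc k)) v) i)

    act-zero : ∀ p {v} → (∀ i → v i ≡ 0ℤ) → ∀ i → act S p v i ≡ 0ℤ
    act-zero []      v≡0 i = refl
    act-zero (a ∷ p) v≡0 i = cong₂ _+_ (≡.trans (cong (a *_) (v≡0 i)) (ℤ.*-zeroʳ a)) (⊙-zero S (act-zero p v≡0) i)

    act-vcong : ∀ p {u v} → (∀ i → u i ≡ v i) → ∀ i → act S p u i ≡ act S p v i
    act-vcong []      u≗v i = refl
    act-vcong (a ∷ p) u≗v i = cong₂ _+_ (cong (a *_) (u≗v i)) (⊙-cong {S = S} (act-vcong p u≗v) i)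

    act-+ : ∀ p q v i → act S (p +P q) v i ≡ act S p v i + act S q v i
    act-+ []      q       v i = ≡.sym (ℤ.+-identityˡ _)
    act-+ (a ∷ p) []      v i = ≡.sym (ℤ.+-identityʳ _)
    act-+ (a ∷ p) (b ∷ q) v i = ≡.trans
      (cong (_+_ ((a + b) * v i)) (≡.trans (⊙-cong {S = S} (act-+ p q v) i) (⊙-+ S (act S p v) (act S q v) i)))
      (rearrange a b (v i) _ _)
      where
      rearrange : ∀ a b x y z → (a + b) * x + (y + z) ≡ (a * x + y) + (b * x + z)
      rearrange = solve-∀

    act-scale : ∀ a p v i → act S (scale a p) v i ≡ a * act S p v i
    act-scale a []      v i = ≡.sym (ℤ.*-zeroʳ a)
    act-scale a (b ∷ p) v i = ≡.trans
      (cong (_+_ (a * b * v i)) (≡.trans (⊙-cong {S = S} (act-scale a p v) i) (⊙-scale S a (act S p v) i)))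
      (rearrange a b (v i) _)
      where
      rearrange : ∀ a b x y → (a * b) * x + a * y ≡ a * (b * x + y)
      rearrange = solve-∀

    act-* : ∀ p q v i → act S (p *P q) v i ≡ act S p (act S q v) i
    act-* []      q v i = refl
    act-* (a ∷ p) q v i = ≡.trans (act-+ (scale a q) (0ℤ ∷ (p *P q)) v i)
      (cong₂ _+_ (act-scale a q v i)
        (≡.trans (ℤ.+-identityˡ _) (⊙-cong {S = S} (act-* p q v) i)))

    act-v+ : ∀ p u v i → act S p (λ k → u k + v k) i ≡ act S p u i + act S p v i
    act-v+ []      u v i = refl
    act-v+ (a ∷ p) u v i = ≡.trans
      (cong (_+_ (a * (u i + v i))) (≡.trans (⊙-cong {S = S} (act-v+ p u v) i) (⊙-+ S (act S p u) (act S p v) i)))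
      (rearrange a (u i) (v i) _ _)
      where
      rearrange : ∀ a x y u v → a * (x + y) + (u + v) ≡ (a * x + u) + (a * y + v)
      rearrange = solve-∀

    act-vsum : ∀ {m} p (w : Fin m → ℤVec n) i →
      act S p (λ k → sum (λ j → w j k)) i ≡ sum (λ j → act S p (w j) i)
    act-vsum {zero}  p w i = act-zero p (λ _ → refl) i
    act-vsum {suc m} p w i = ≡.trans (act-v+ p (w zero) (λ k → sum (λ j → w (suc j) k)) i)
      (cong (_+_ (act S p (w zero) i)) (act-vsum p (w ∘ suc) i))

    act-sum : ∀ {m} (p : Fin m → Poly) v i → act S (ΣP.sum p) v i ≡ sum (λ j → act S (p j) v i)
    act-sum {zero}  p v i = refl
    act-sum {suc m} p v i = ≡.trans (act-+ (p zero) (ΣP.sum (p ∘ suc)) v i)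
      (cong (_+_ (act S (p zero) v i)) (act-sum (p ∘ suc) v i))

  charMatrix : ∀ {n} → Matrix n → Fin n → Fin n → Poly
  charMatrix S i j = (if does (i ≟ j) then X else []) +P C (- S i j)

  act-C : ∀ {n} (S : Matrix n) a v l → act S (C a) v l ≡ a * v l
  act-C S a v l = ≡.trans (cong (_+_ (a * v l)) (⊙-zero S (λ _ → refl) l)) (ℤ.+-identityʳ _)

  act-X : ∀ {n} (S : Matrix n) v l → act S X v l ≡ (v ⊙ S) l
  act-X S v l = ≡.trans (ℤ.+-identityˡ _)
    (⊙-cong {S = S} (λ i → ≡.trans (act-C S 1ℤ v i) (ℤ.*-identityˡ (v i))) l)

  -- Row i of X I − S annihilates the standard basis, X acting as multiplication by S.
  charMatrix-act : ∀ {n} (S : Matrix n) i l → sum (λ j → act S (charMatrix S i j) (e j) l) ≡ 0ℤ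
  charMatrix-act {n} S i l = begin
    sum (λ j → act S (charMatrix S i j) (e j) l)
      ≡⟨ sum-cong-≗ entry ⟩
    sum (λ j → e i j * (e j ⊙ S) l + - S i j * e j l)
      ≡⟨ ∑-distrib-+ (λ j → e i j * (e j ⊙ S) l) (λ j → - S i j * e j l) ⟩
    sum (λ j → e i j * (e j ⊙ S) l) + sum (λ j → - S i j * e j l)
      ≡⟨ cong₂ _+_ (≡.trans (sum-e (λ j → (e j ⊙ S) l) i) (e-⊙ S i l)) (Dℤ.sum-δ (λ j → - S i j) l) ⟩
    S i l + - S i l
      ≡⟨ ℤ.+-inverseʳ (S i l) ⟩
    0ℤ ∎
    where
    open ≡.≡-Reasoning
    entry : ∀ j → act S (charMatrix S i j) (e j) l ≡ e i j * (e j ⊙ S) l + - S i j * e j l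
    entry j = ≡.trans (act-+ S (if does (i ≟ j) then X else []) (C (- S i j)) (e j) l)
                      (cong₂ _+_ diagonal (act-C S (- S i j) (e j) l))
      where
      diagonal : act S (if does (i ≟ j) then X else []) (e j) l ≡ e i j * (e j ⊙ S) l
      diagonal with does (i ≟ j)
      ... | true  = ≡.trans (act-X S (e j) l) (≡.sym (ℤ.*-identityˡ _))
      ... | false = ≡.sym (ℤ.*-zeroˡ ((e j ⊙ S) l))

  -- Row vectors form a module over the polynomials with X acting as S. The matrix X I - S kills the
  -- tuple of the e_j in this module; multiplying by its adjugate leaves `charPoly S` acting on e_c.
  cayley-hamilton-e : ∀ {n} (S : Matrix n) c l → act S (charPoly S) (e c) l ≡ 0ℤ
  cayley-hamilton-e {n} S c l = begin
    act S (charPoly S) (e c) l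
      ≡⟨ act-cong S (det≋det A) (e c) l ⟩
    act S d (e c) l
      ≡⟨ sum-e (λ j → act S d (e j) l) c ⟨
    sum (λ j → e c j * act S d (e j) l)
      ≡⟨ sum-cong-≗ (λ j → diagonal j) ⟨
    sum (λ j → act S (D.δ c j *P d) (e j) l)
      ≡⟨ sum-cong-≗ (λ j → act-cong S (D.adjugate-mul A c j) (e j) l) ⟨
    sum (λ j → act S (ΣP.sum (λ i → A i j *P B i)) (e j) l)
      ≡⟨ sum-cong-≗ (λ j → ≡.trans (act-sum S (λ i → A i j *P B i) (e j) l)
                            (sum-cong-≗ λ i → ≡.trans (act-cong S (*P-comm (A i j) (B i)) (e j) l)
                                                     (act-* S (B i) (A i j) (e j) l))) ⟩
    sum (λ j → sum (λ i → act S (B i) (act S (A i j) (e j)) l))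
      ≡⟨ ∑-comm (λ j i → act S (B i) (act S (A i j) (e j)) l) ⟩
    sum (λ i → sum (λ j → act S (B i) (act S (A i j) (e j)) l))
      ≡⟨ Dℤ.sum-zero (λ i → ≡.trans (≡.sym (act-vsum S (B i) (λ j → act S (A i j) (e j)) l))
                               (act-zero S (B i) (charMatrix-act S i) l)) ⟩
    0ℤ ∎
    where
    open ≡.≡-Reasoning
    A = charMatrix S
    d = D.det A
    B : Fin n → Poly
    B = D.adjugate A c
    diagonal : ∀ j → act S (D.δ c j *P d) (e j) l ≡ e c j * act S d (e j) l
    diagonal j with does (c ≟ j)
    ... | true  = ≡.trans (act-cong S (*P-identityˡ d) (e j) l) (≡.sym (ℤ.*-identityˡ _))
    ... | false = ≡.sym (ℤ.*-zeroˡ (act S d (e j) l))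

  cayley-hamilton : ∀ {n} (S : Matrix n) v l → act S (charPoly S) v l ≡ 0ℤ
  cayley-hamilton S v l = begin
    act S p v l
      ≡⟨ act-vcong S p (λ k → Dℤ.sum-δ v k) l ⟨
    act S p (λ k → sum (λ j → v j * e j k)) l
      ≡⟨ act-vsum S p (λ j k → v j * e j k) l ⟩
    sum (λ j → act S p (λ k → v j * e j k) l)
      ≡⟨ Dℤ.sum-zero (λ j → ≡.trans (scaled j) (≡.trans (cong (v j *_) (cayley-hamilton-e S j l)) (ℤ.*-zeroʳ (v j)))) ⟩
    0ℤ ∎
    where
    open ≡.≡-Reasoning
    p = charPoly S
    scaled : ∀ j → act S p (λ k → v j * e j k) l ≡ v j * act S p (e j) l
    scaled j = begin
      act S p (λ k → v j * e j k) l     ≡⟨ act-vcong S p (act-C S (v j) (e j)) l ⟨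
      act S p (act S (C (v j)) (e j)) l ≡⟨ act-* S p (C (v j)) (e j) l ⟨
      act S (p *P C (v j)) (e j) l      ≡⟨ act-cong S (*P-comm p (C (v j))) (e j) l ⟩
      act S (C (v j) *P p) (e j) l      ≡⟨ act-* S (C (v j)) p (e j) l ⟩
      act S (C (v j)) (act S p (e j)) l ≡⟨ act-C S (v j) (act S p (e j)) l ⟩
      v j * act S p (e j) l             ∎

-- Integer sums, inner products and sign arguments

module Spectral where

  open import Defs
  open Polynomials
  open import Data.Empty using (⊥; ⊥-elim)
  open import Data.Fin using (Fin; zero; suc; _≟_)
  open import Data.Fin.Properties using (¬∀⟶∃¬)
  open import Data.Integer as ℤ using (ℤ; +_; -[1+_]; -_; _+_; _*_; _-_; -1ℤ; 0ℤ; 1ℤ; _≤_; _<_; +≤+; +<+; ∣_∣)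
  import Data.Integer.Properties as ℤ
  open import Data.Integer.Tactic.RingSolver using (solve-∀)
  open import Data.Nat as ℕ using (ℕ; zero; suc; s≤s; z≤n)
  import Data.Nat.Properties as ℕ
  open import Data.Product using (∃; _×_; _,_; proj₁; proj₂)
  open import Data.Sum using (_⊎_; inj₁; inj₂; fromInj₁; fromInj₂)
  open import Function using (_∘_)
  open import Relation.Binary.PropositionalEquality as ≡ using (_≡_; _≢_; refl; cong; cong₂; sym; trans; subst)
  open import Relation.Nullary using (yes; no; ¬_; contradiction; Dec)
  open Σℤ using (sum; sum-cong-≗; ∑-distrib-+; ∑-comm; *-distribˡ-sum; *-distribʳ-sum)

  sum-linear : ∀ {n} a b (f g : ℤVec n) → sum (λ i → a * f i + b * g i) ≡ a * sum f + b * sum g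
  sum-linear a b f g = trans (∑-distrib-+ (λ i → a * f i) (λ i → b * g i))
    (sym (cong₂ _+_ (*-distribˡ-sum a f) (*-distribˡ-sum b g)))

  sum-neg : ∀ {n} (f : ℤVec n) → sum (λ i → - f i) ≡ - sum f
  sum-neg f = trans (sum-cong-≗ λ i → sym (ℤ.-1*i≡-i (f i))) (trans (sym (*-distribˡ-sum -1ℤ f)) (ℤ.-1*i≡-i (sum f)))

  sum-nonneg : ∀ {n} {f : ℤVec n} → (∀ i → 0ℤ ≤ f i) → 0ℤ ≤ sum f
  sum-nonneg {zero}  f≥0 = ℤ.≤-refl
  sum-nonneg {suc n} f≥0 = ℤ.+-mono-≤ (f≥0 zero) (sum-nonneg (f≥0 ∘ suc))

  sum-mono : ∀ {n} {f g : ℤVec n} → (∀ i → f i ≤ g i) → sum f ≤ sum g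
  sum-mono {zero}  f≤g = ℤ.≤-refl
  sum-mono {suc n} f≤g = ℤ.+-mono-≤ (f≤g zero) (sum-mono (f≤g ∘ suc))

  nonneg-sum-zero : ∀ {x y} → 0ℤ ≤ x → 0ℤ ≤ y → x + y ≡ 0ℤ → x ≡ 0ℤ × y ≡ 0ℤ
  nonneg-sum-zero {+ 0} {+ 0} _ _ _ = refl , refl
  nonneg-sum-zero {+ 0} {+ suc y} _ _ ()
  nonneg-sum-zero {+ suc x} {+ y} _ _ ()

  sum-nonneg-zero : ∀ {n} {f : ℤVec n} → (∀ i → 0ℤ ≤ f i) → sum f ≡ 0ℤ → ∀ i → f i ≡ 0ℤ
  sum-nonneg-zero {suc n} f≥0 Σ≡0 i with nonneg-sum-zero (f≥0 zero) (sum-nonneg (f≥0 ∘ suc)) Σ≡0 | i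
  ... | p , q | zero = p
  ... | p , q | suc j = sum-nonneg-zero (f≥0 ∘ suc) q j

  square-nonneg : ∀ x → 0ℤ ≤ x * x
  square-nonneg (+ n) = subst (0ℤ ≤_) (ℤ.pos-* n n) (+≤+ z≤n)
  square-nonneg -[1+ n ] = +≤+ z≤n

  square-zero : ∀ x → x * x ≡ 0ℤ → x ≡ 0ℤ
  square-zero x xx≡0 with ℤ.i*j≡0⇒i≡0∨j≡0 x xx≡0
  ... | inj₁ p = p
  ... | inj₂ p = p

  infix 8 ⟨_,_⟩
  opaque
    ⟨_,_⟩ : ∀ {n} → ℤVec n → ℤVec n → ℤ
    ⟨ u , v ⟩ = sum (λ i → u i * v i)

    dot-congˡ : ∀ {n} (w : ℤVec n) {u v} → (∀ i → u i ≡ v i) → ⟨ u , w ⟩ ≡ ⟨ v , w ⟩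
    dot-congˡ w u≗v = sum-cong-≗ λ i → cong (_* w i) (u≗v i)

    dot-congʳ : ∀ {n} (w : ℤVec n) {u v} → (∀ i → u i ≡ v i) → ⟨ w , u ⟩ ≡ ⟨ w , v ⟩
    dot-congʳ w u≗v = sum-cong-≗ λ i → cong (w i *_) (u≗v i)

    dot-comm : ∀ {n} (u v : ℤVec n) → ⟨ u , v ⟩ ≡ ⟨ v , u ⟩
    dot-comm u v = sum-cong-≗ λ i → ℤ.*-comm (u i) (v i)

    dot-linearʳ : ∀ {n} a b (u v w : ℤVec n) → ⟨ w , (λ i → a * u i + b * v i) ⟩ ≡ a * ⟨ w , u ⟩ + b * ⟨ w , v ⟩
    dot-linearʳ a b u v w = trans (sum-cong-≗ λ i → rearrange a b (u i) (v i) (w i))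
      (sum-linear a b (λ i → w i * u i) (λ i → w i * v i))
      where
      rearrange : ∀ a b x y z → z * (a * x + b * y) ≡ a * (z * x) + b * (z * y)
      rearrange = solve-∀

    dot-linearˡ : ∀ {n} a b (u v w : ℤVec n) → ⟨ (λ i → a * u i + b * v i) , w ⟩ ≡ a * ⟨ u , w ⟩ + b * ⟨ v , w ⟩
    dot-linearˡ a b u v w = trans (dot-comm _ w)
      (trans (dot-linearʳ a b u v w) (cong₂ (λ x y → a * x + b * y) (dot-comm w u) (dot-comm w v)))

    dot-e : ∀ {n} i (v : ℤVec n) → ⟨ e i , v ⟩ ≡ v i
    dot-e i v = sum-e v i

    norm-nonneg : ∀ {n} (v : ℤVec n) → 0ℤ ≤ ⟨ v , v ⟩
    norm-nonneg v = sum-nonneg (λ i → square-nonneg (v i))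

    norm-zero : ∀ {n} (v : ℤVec n) → ⟨ v , v ⟩ ≡ 0ℤ → ∀ i → v i ≡ 0ℤ
    norm-zero v vv≡0 i = square-zero (v i) (sum-nonneg-zero (λ k → square-nonneg (v k)) vv≡0 i)

    dot-def : ∀ {n} (u v : ℤVec n) → ⟨ u , v ⟩ ≡ sum (λ i → u i * v i)
    dot-def u v = refl

  e-diag : ∀ {n} (i : Fin n) → e i i ≡ 1ℤ
  e-diag i with i ≟ i
  ... | yes _ = refl
  ... | no i≢i = contradiction refl i≢i

  e-off : ∀ {n} {i j : Fin n} → i ≢ j → e i j ≡ 0ℤ
  e-off {i = i} {j} i≢j with i ≟ j
  ... | yes i≡j = contradiction i≡j i≢j
  ... | no _ = refl

  sum-e-one : ∀ {n} (i : Fin n) → sum (e i) ≡ 1ℤ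
  sum-e-one i = trans (sum-cong-≗ λ k → sym (ℤ.*-identityʳ (e i k))) (sum-e (λ _ → 1ℤ) i)

  -- The symmetric operators S² + a of a skew-symmetric S

  module SkewOperators {n} (S : Matrix n) (skew : ∀ i j → S j i ≡ - S i j) where

    T : ℤVec n → ℤVec n
    T v = v ⊙ S

    opaque
      -- `N a` is S² + a; for a = 4t + 3 and a = 3 these are the quadratic factors of the
      -- characteristic polynomial, evaluated at S.
      N : ℤ → ℤVec n → ℤVec n
      N a v i = T (T v) i + a * v i

      N-def : ∀ a v i → N a v i ≡ T (T v) i + a * v i
      N-def a v i = refl

    T-cong : ∀ {u v} → (∀ i → u i ≡ v i) → ∀ i → T u i ≡ T v i
    T-cong = ⊙-cong {S = S}

    opaque
      unfolding N

      N-cong : ∀ a {u v} → (∀ i → u i ≡ v i) → ∀ i → N a u i ≡ N a v i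
      N-cong a u≗v i = cong₂ (λ x y → x + a * y) (T-cong (T-cong u≗v) i) (u≗v i)

    T-linear : ∀ a b u v i → T (λ k → a * u k + b * v k) i ≡ a * T u i + b * T v i
    T-linear = ⊙-linear S

    opaque
      unfolding N

      N-linear : ∀ c a b u v i → N c (λ k → a * u k + b * v k) i ≡ a * N c u i + b * N c v i
      N-linear c a b u v i = trans
        (cong (_+ c * (a * u i + b * v i)) (trans (T-cong (T-linear a b u v) i) (T-linear a b (T u) (T v) i)))
        (rearrange a b c (T (T u) i) (T (T v) i) (u i) (v i))
        where
        rearrange : ∀ a b c x y u v → (a * x + b * y) + c * (a * u + b * v) ≡ a * (x + c * u) + b * (y + c * v)
        rearrange = solve-∀

    T-scale : ∀ a v i → T (λ k → a * v k) i ≡ a * T v i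
    T-scale = ⊙-scale S

    opaque
      unfolding N

      T-N : ∀ a v i → T (N a v) i ≡ N a (T v) i
      T-N a v i = trans (⊙-+ S (T (T v)) (λ k → a * v k) i) (cong (_+_ (T (T (T v)) i)) (T-scale a v i))

      N-scale : ∀ c a v i → N c (λ k → a * v k) i ≡ a * N c v i
      N-scale c a v i = trans (cong (_+ c * (a * v i)) (trans (T-cong (T-scale a v) i) (T-scale a (T v) i)))
        (rearrange a c (T (T v) i) (v i))
        where
        rearrange : ∀ a c x y → a * x + c * (a * y) ≡ a * (x + c * y)
        rearrange = solve-∀

      N-comm : ∀ a b v i → N a (N b v) i ≡ N b (N a v) i
      N-comm a b v i = trans (expand a b) (trans (rearrange a b (T (T (T (T v))) i) (T (T v) i) (v i)) (sym (expand b a)))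
        where
        expand : ∀ a b → N a (N b v) i ≡ (N b (T (T v)) i) + a * N b v i
        expand a b = cong (_+ a * N b v i) (trans (T-cong (T-N b v) i) (T-N b (T v) i))
        rearrange : ∀ a b x y z → (x + b * y) + a * (y + b * z) ≡ (x + a * y) + b * (y + a * z)
        rearrange = solve-∀

    opaque
      unfolding ⟨_,_⟩

      T-skew : ∀ u v → ⟨ T u , v ⟩ ≡ - ⟨ u , T v ⟩
      T-skew u v = begin
        sum (λ j → T u j * v j)                        ≡⟨ sum-cong-≗ (λ j → cong (_* v j) (⊙-def u S j)) ⟩
        sum (λ j → sum (λ i → u i * S i j) * v j)      ≡⟨ sum-cong-≗ (λ j → *-distribʳ-sum (v j) (λ i → u i * S i j)) ⟩
        sum (λ j → sum (λ i → u i * S i j * v j))      ≡⟨ ∑-comm (λ j i → u i * S i j * v j) ⟩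
        sum (λ i → sum (λ j → u i * S i j * v j))      ≡⟨ sum-cong-≗ (λ i → trans (sum-cong-≗ λ j → entry i j) (trans (sym (*-distribˡ-sum (- u i) (λ j → v j * S j i))) (cong (- u i *_) (sym (⊙-def v S i))))) ⟩
        sum (λ i → - u i * T v i)                      ≡⟨ sum-cong-≗ (λ i → sym (ℤ.neg-distribˡ-* (u i) (T v i))) ⟩
        sum (λ i → - (u i * T v i))                    ≡⟨ sum-neg (λ i → u i * T v i) ⟩
        - ⟨ u , T v ⟩                                  ∎
        where
        open ≡.≡-Reasoning
        flip : ∀ u s v → u * - s * v ≡ - u * (v * s)
        flip = solve-∀
        entry : ∀ i j → u i * S i j * v j ≡ - u i * (v j * S j i)
        entry i j = trans (cong (λ s → u i * s * v j) (skew j i)) (flip (u i) (S j i) (v j))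

    dot-T : ∀ v → ⟨ T v , v ⟩ ≡ 0ℤ
    dot-T v = self-neg (trans (T-skew v v) (cong -_ (dot-comm v (T v))))
      where
      self-neg : ∀ {x} → x ≡ - x → x ≡ 0ℤ
      self-neg {+ 0} _ = refl

    opaque
      unfolding N

      N-sym : ∀ a u v → ⟨ N a u , v ⟩ ≡ ⟨ u , N a v ⟩
      N-sym a u v = begin
        ⟨ N a u , v ⟩                              ≡⟨ expandˡ ⟩
        ⟨ T (T u) , v ⟩ + a * ⟨ u , v ⟩            ≡⟨ cong (_+ a * ⟨ u , v ⟩) twice ⟩
        ⟨ u , T (T v) ⟩ + a * ⟨ u , v ⟩            ≡⟨ expandʳ ⟨
        ⟨ u , N a v ⟩                              ∎
        where
        open ≡.≡-Reasoning
        twice : ⟨ T (T u) , v ⟩ ≡ ⟨ u , T (T v) ⟩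
        twice = trans (T-skew (T u) v) (trans (cong -_ (T-skew u (T v))) (ℤ.neg-involutive ⟨ u , T (T v) ⟩))
        expandʳ : ⟨ u , N a v ⟩ ≡ ⟨ u , T (T v) ⟩ + a * ⟨ u , v ⟩
        expandʳ = trans (dot-congʳ u (λ i → cong (_+ a * v i) (sym (ℤ.*-identityˡ (T (T v) i)))))
          (trans (dot-linearʳ 1ℤ a (T (T v)) v u) (cong (_+ a * ⟨ u , v ⟩) (ℤ.*-identityˡ ⟨ u , T (T v) ⟩)))
        expandˡ : ⟨ N a u , v ⟩ ≡ ⟨ T (T u) , v ⟩ + a * ⟨ u , v ⟩
        expandˡ = trans (dot-congˡ v (λ i → cong (_+ a * u i) (sym (ℤ.*-identityˡ (T (T u) i)))))
          (trans (dot-linearˡ 1ℤ a (T (T u)) u v) (cong (_+ a * ⟨ u , v ⟩) (ℤ.*-identityˡ ⟨ T (T u) , v ⟩)))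

    -- A symmetric integer operator has no nilpotent part.
    N-reduced : ∀ a v → (∀ i → N a (N a v) i ≡ 0ℤ) → ∀ i → N a v i ≡ 0ℤ
    N-reduced a v NNv≡0 = norm-zero (N a v) (trans (N-sym a v (N a v))
      (trans (dot-def v _) (Dℤ.sum-zero λ i → trans (cong (v i *_) (NNv≡0 i)) (ℤ.*-zeroʳ (v i)))))

    opaque
      unfolding N

      act-X²+C : ∀ a v i → act S (X *P X +P C a) v i ≡ N a v i
      act-X²+C a v i = trans (act-+ S (X *P X) (C a) v i)
        (cong₂ _+_ (trans (act-* S X X v i) (trans (act-X S (act S X v) i) (T-cong (act-X S v) i))) (act-C S a v i))

    -- `N-reduced` merges the two outermost factors, so a power acts as zero only if its base
    -- already does.
    power-reduced : ∀ a k v → (∀ i → act S ((X *P X +P C a) ^P suc k) v i ≡ 0ℤ) → ∀ i → N a v i ≡ 0ℤ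
    power-reduced a zero v h i = trans (sym (once i)) (h i)
      where
      Y = X *P X +P C a
      once : ∀ i → act S (Y ^P 1) v i ≡ N a v i
      once i = trans (act-cong S (≋-trans (*P-comm Y (C 1ℤ)) (*P-identityˡ Y)) v i) (act-X²+C a v i)
    power-reduced a (suc k) v h = power-reduced a k v λ i →
      trans (succ i (Y ^P k)) (N-reduced a (act S (Y ^P k) v) (λ i →
        trans (sym (trans (succ i (Y ^P suc k)) (N-cong a (λ i → succ i (Y ^P k)) i))) (h i)) i)
      where
      Y = X *P X +P C a
      succ : ∀ i p → act S (Y *P p) v i ≡ N a (act S p v) i
      succ i p = trans (act-* S Y p v i) (act-X²+C a (act S p v) i)

    -- Cayley-Hamilton gives this with the first factor to the power k + 1; symmetry of S² + a, in
    -- place of diagonalisation, lowers the power to one.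
    annihilated : ∀ a b k →
      charPoly S ≈P ((X *P X +P C a) ^P suc k *P (X *P X +P C b) *P X) →
      ∀ v i → N a (N b (T v)) i ≡ 0ℤ
    annihilated a b k spectrum v = power-reduced a k (N b (T v)) λ i → begin
      act S P (N b (T v)) i              ≡⟨ act-vcong S P (λ i → trans (act-vcong S Q (act-X S v) i) (act-X²+C b (T v) i)) i ⟨
      act S P (act S Q (act S X v)) i    ≡⟨ act-* S P Q (act S X v) i ⟨
      act S (P *P Q) (act S X v) i       ≡⟨ act-* S (P *P Q) X v i ⟨
      act S (P *P Q *P X) v i            ≡⟨ act-cong S {charPoly S} {P *P Q *P X} (coeffs spectrum) v i ⟨
      act S (charPoly S) v i             ≡⟨ cayley-hamilton S v i ⟩
      0ℤ                                 ∎
      where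
      open ≡.≡-Reasoning
      P = (X *P X +P C a) ^P suc k
      Q = X *P X +P C b

  IsUnit : ℤ → Set
  IsUnit ε = ε ≡ 1ℤ ⊎ ε ≡ -1ℤ

  unit-square : ∀ {ε} → IsUnit ε → ε * ε ≡ 1ℤ
  unit-square (inj₁ refl) = refl
  unit-square (inj₂ refl) = refl

  unit-neg : ∀ {ε} → IsUnit ε → IsUnit (- ε)
  unit-neg (inj₁ refl) = inj₂ refl
  unit-neg (inj₂ refl) = inj₁ refl

  nonneg-cancel : ∀ {a x} → 0ℤ < a → 0ℤ ≤ a * x → 0ℤ ≤ x
  nonneg-cancel {a} {x} 0<a 0≤ax = ℤ.*-cancelˡ-≤-pos 0ℤ x a {{ℤ.positive 0<a}} (subst (_≤ a * x) (sym (ℤ.*-zeroʳ a)) 0≤ax)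

  -- Typical use: a sum of nonnegative terms is rewritten by a ring identity into a negative
  -- constant.
  absurd-nonneg : ∀ {x k} → 0ℤ ≤ x → x ≡ -[1+ k ] → ⊥
  absurd-nonneg () refl

  -- The sign is kept because an entry 3 ε of M makes two of its rows proportional with factor ε.
  data Small : ℤ → Set where
    unit   : ∀ {ε} → IsUnit ε → Small ε
    triple : ∀ {ε} → IsUnit ε → Small (+ 3 * ε)

  level : ∀ {z} → Small z → ℤ
  level (unit _)   = 0ℤ
  level (triple _) = 1ℤ

  small-square : ∀ {z} (s : Small z) → z * z ≡ 1ℤ + + 8 * level s
  small-square (unit u) = unit-square u
  small-square (triple (inj₁ refl)) = refl
  small-square (triple (inj₂ refl)) = refl

  -- The hypotheses are the values of the form of M at e_i + e_j and e_i - e_j, the 6 coming from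
  -- two diagonal entries 3. They bound the odd number by 3 in absolute value.
  odd-bounded : ∀ h → 0ℤ ≤ + 6 + + 2 * (1ℤ + + 2 * h) → 0ℤ ≤ + 6 + - + 2 * (1ℤ + + 2 * h) → Small (1ℤ + + 2 * h)
  odd-bounded (+ 0) _ _ = unit (inj₁ refl)
  odd-bounded (+ 1) _ _ = triple (inj₁ refl)
  odd-bounded (+ suc (suc k)) _ q =
    ⊥-elim (absurd-nonneg (ℤ.+-mono-≤ q (ℤ.*-monoˡ-≤-nonNeg (+ 4) (+≤+ (z≤n {k}))))
      (trans (identity (+ k)) refl))
    where
    identity : ∀ k → + 6 + - + 2 * (1ℤ + + 2 * (+ 2 + k)) + + 4 * k ≡ - + 4
    identity = solve-∀
  odd-bounded -[1+ 0 ] _ _ = unit (inj₂ refl)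
  odd-bounded -[1+ 1 ] _ _ = triple (inj₂ refl)
  odd-bounded -[1+ suc (suc k) ] p _ =
    ⊥-elim (absurd-nonneg (ℤ.+-mono-≤ p (ℤ.*-monoˡ-≤-nonNeg (+ 4) (+≤+ (z≤n {k}))))
      (trans (identity (+ k)) refl))
    where
    identity : ∀ k → + 6 + + 2 * (1ℤ + + 2 * (- (+ 3 + k))) + + 4 * k ≡ - + 4
    identity = solve-∀

  -- The kernel of a skew Seidel matrix modulo 2

  module SkewSeidel {n} (S : Matrix n) (seidel : IsSkewSeidel S) where

    skew : ∀ i j → S j i ≡ - S i j
    skew = proj₂ (proj₂ seidel)

    open SkewOperators S skew public

    S-square : ∀ i k → S i k * S i k ≡ 1ℤ + - e i k
    S-square i k with i ≟ k
    ... | yes refl = cong (λ s → s * s) (proj₁ seidel i)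
    ... | no i≢k = unit-square (proj₁ (proj₂ seidel) i k i≢k)

    -- The congruence S ≡ J - I modulo 2 with explicit quotients, which `half-odd` extracts.
    S-odd : ∀ i j → ∃ λ h → S i j ≡ (1ℤ + - e j i) + + 2 * h
    S-odd i j with j ≟ i
    ... | yes refl = 0ℤ , proj₁ seidel i
    ... | no j≢i with proj₁ (proj₂ seidel) i j (j≢i ∘ sym)
    ...   | inj₁ p = 0ℤ , p
    ...   | inj₂ p = -1ℤ , p

    half-odd : Fin n → Fin n → ℤ
    half-odd i j = proj₁ (S-odd i j)

    -- For w in the kernel, `parity` reads w_j = Σ w + 2 H_j. Subtracting the instance at a, where w
    -- vanishes, gives w_j = 2 (H_j - H_a).
    kernel-halves : ∀ w → (∀ j → T w j ≡ 0ℤ) → ∀ a → w a ≡ 0ℤ → ∃ λ w′ → ∀ j → w j ≡ + 2 * w′ j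
    kernel-halves w Tw≡0 a wa≡0 = (λ j → H j - H a) , λ j → begin
      w j                              ≡⟨ rearrange (w j) (sum w) (H j) (H a) (w a) ⟩
      + 2 * (H j - H a) + (- (sum w + - w j + + 2 * H j) + (sum w + - w a + + 2 * H a)) + w a
        ≡⟨ cong₂ (λ x y → + 2 * (H j - H a) + (- x + y) + w a) (parity j) (parity a) ⟨
      + 2 * (H j - H a) + (- T w j + T w a) + w a
        ≡⟨ cong₂ (λ x y → + 2 * (H j - H a) + x + y) (cong₂ (λ x y → - x + y) (Tw≡0 j) (Tw≡0 a)) wa≡0 ⟩
      + 2 * (H j - H a) + 0ℤ + 0ℤ     ≡⟨ trans (ℤ.+-identityʳ _) (ℤ.+-identityʳ _) ⟩
      + 2 * (H j - H a)                ∎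
      where
      open ≡.≡-Reasoning
      H : Fin n → ℤ
      H j = sum (λ i → w i * half-odd i j)
      rearrange : ∀ x s h k y → x ≡ + 2 * (h - k) + (- (s + - x + + 2 * h) + (s + - y + + 2 * k)) + y
      rearrange = solve-∀
      split : ∀ w e h → w * ((1ℤ + - e) + + 2 * h) ≡ 1ℤ * (1ℤ * w + -1ℤ * (e * w)) + + 2 * (w * h)
      split = solve-∀
      units : ∀ x y z → 1ℤ * (1ℤ * x + -1ℤ * y) + z ≡ x + - y + z
      units = solve-∀
      parity : ∀ j → T w j ≡ sum w + - w j + + 2 * H j
      parity j = begin
        T w j
          ≡⟨ ⊙-def w S j ⟩
        sum (λ i → w i * S i j)
          ≡⟨ sum-cong-≗ (λ i → trans (cong (w i *_) (proj₂ (S-odd i j))) (split (w i) (e j i) (half-odd i j))) ⟩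
        sum (λ i → 1ℤ * (1ℤ * w i + -1ℤ * (e j i * w i)) + + 2 * (w i * half-odd i j))
          ≡⟨ sum-linear 1ℤ (+ 2) (λ i → 1ℤ * w i + -1ℤ * (e j i * w i)) (λ i → w i * half-odd i j) ⟩
        1ℤ * sum (λ i → 1ℤ * w i + -1ℤ * (e j i * w i)) + + 2 * H j
          ≡⟨ cong (λ z → 1ℤ * z + + 2 * H j) (trans (sum-linear 1ℤ -1ℤ w (λ i → e j i * w i))
               (cong (λ z → 1ℤ * sum w + -1ℤ * z) (sum-e w j))) ⟩
        1ℤ * (1ℤ * sum w + -1ℤ * w j) + + 2 * H j
          ≡⟨ units (sum w) (w j) (+ 2 * H j) ⟩
        sum w + - w j + + 2 * H j ∎

    -- Modulo 2 the kernel of S is spanned by the all-ones vector, so a kernel vector with a zero entry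
    -- can be halved forever.
    kernel-vanishes : ∀ w → (∀ j → T w j ≡ 0ℤ) → ∀ a → w a ≡ 0ℤ → ∀ i → w i ≡ 0ℤ
    kernel-vanishes w Tw≡0 a wa≡0 i = descend ∣ w i ∣ w Tw≡0 wa≡0 ℕ.≤-refl
      where
      half-≤ : ∀ x k → 2 ℕ.* x ℕ.≤ suc k → x ℕ.≤ k
      half-≤ zero    k _ = z≤n
      half-≤ (suc x) k (s≤s p) = ℕ.≤-trans (ℕ.≤-trans (ℕ.m≤m+n (suc x) 0) (ℕ.m≤n+m (suc x ℕ.+ 0) x)) p
      -- Halving preserves both the kernel equation and the zero at a, while the bound k on the size
      -- of entry i drops by one; at bound 0 the entry is 0.
      descend : ∀ k w → (∀ j → T w j ≡ 0ℤ) → w a ≡ 0ℤ → ∣ w i ∣ ℕ.≤ k → w i ≡ 0ℤ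
      descend zero w _ _ small = ℤ.∣i∣≡0⇒i≡0 (ℕ.n≤0⇒n≡0 small)
      descend (suc k) w Tw≡0 wa≡0 small with kernel-halves w Tw≡0 a wa≡0
      ... | w′ , w≡2w′ = trans (w≡2w′ i) (cong (+ 2 *_) (descend k w′
              (λ j → cancel2 (trans (sym (T-scale (+ 2) w′ j)) (trans (T-cong (sym ∘ w≡2w′) j) (Tw≡0 j))))
              (cancel2 (trans (sym (w≡2w′ a)) wa≡0))
              (half-≤ ∣ w′ i ∣ k (subst (ℕ._≤ suc k) (trans (cong ∣_∣ (w≡2w′ i)) (ℤ.abs-* (+ 2) (w′ i))) small))))
        where
        cancel2 : ∀ {x} → + 2 * x ≡ 0ℤ → x ≡ 0ℤ
        cancel2 {x} p = ℤ.*-cancelˡ-≡ (+ 2) x 0ℤ p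

  -- Semidefiniteness of M and F, and the entries of M

  module Structure {n} (o : Fin n) (S : Matrix n) (seidel : IsSkewSeidel S) (τ r : ℤ) (1≤τ : 1ℤ ≤ τ) (r≡4τ : r ≡ + 4 * τ)
    (card : sum {n} (λ _ → 1ℤ) ≡ r + 1ℤ)
    (spectrum : ∀ v i → SkewSeidel.N S seidel (r + + 3) (SkewSeidel.N S seidel (+ 3) (SkewSeidel.T S seidel v)) i ≡ 0ℤ)
    where

    open SkewSeidel S seidel
    open ≡.≡-Reasoning

    m : ℤ
    m = r + + 3

    M F : ℤVec n → ℤVec n
    M = N m
    F v = M (N (+ 3) v)

    0<τ : 0ℤ < τ
    0<τ = ℤ.<-≤-trans (+<+ (s≤s z≤n)) 1≤τ

    0<r : 0ℤ < r
    0<r = subst (0ℤ <_) (sym r≡4τ) (ℤ.*-monoˡ-<-pos (+ 4) 0<τ)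

    0<m : 0ℤ < m
    0<m = ℤ.+-mono-< 0<r (+<+ {0} {3} (s≤s z≤n))

    M-cong : ∀ {u v} → (∀ i → u i ≡ v i) → ∀ i → M u i ≡ M v i
    M-cong = N-cong m

    TF : ∀ v i → T (F v) i ≡ 0ℤ
    TF v i = trans (T-N m (N (+ 3) v) i) (trans (M-cong (T-N (+ 3) v) i) (spectrum v i))

    -- One of the two factors M is split as (S² + 3) + r; the first part turns M into F.
    MM : ∀ v i → M (M v) i ≡ 1ℤ * F v i + r * M v i
    MM v i = trans (M-cong (λ k → trans (N-def m v k) (trans (shift r (T (T v) k) (v k)) (cong (λ z → 1ℤ * z + r * v k) (sym (N-def (+ 3) v k))))) i) (N-linear m 1ℤ r (N (+ 3) v) v i)
      where
      shift : ∀ r x y → x + (r + + 3) * y ≡ 1ℤ * (x + + 3 * y) + r * y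
      shift = solve-∀

    N-F : ∀ a v i → N a (F v) i ≡ a * F v i
    N-F a v i = trans (N-def a (F v) i) (trans (cong (_+ a * F v i) (⊙-zero S (TF v) i)) (ℤ.+-identityˡ (a * F v i)))

    -- S kills the image of F, so on that image S² + 3 and S² + m act as the scalars 3 and m.
    FF : ∀ v i → F (F v) i ≡ + 3 * m * F v i
    FF v i = trans (M-cong (N-F (+ 3) v) i) (trans (N-scale m (+ 3) (F v) i)
      (trans (cong (+ 3 *_) (N-F m v i)) (sym (ℤ.*-assoc (+ 3) m (F v i)))))

    F-sym : ∀ u v → ⟨ F u , v ⟩ ≡ ⟨ u , F v ⟩
    F-sym u v = trans (N-sym m (N (+ 3) u) v) (trans (N-sym (+ 3) u (M v)) (dot-congʳ u (N-comm (+ 3) m v)))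

    F-linear : ∀ a b u v i → F (λ k → a * u k + b * v k) i ≡ a * F u i + b * F v i
    F-linear a b u v i = trans (M-cong (N-linear (+ 3) a b u v) i) (N-linear m a b (N (+ 3) u) (N (+ 3) v) i)

    norm-M : ∀ u → ⟨ M u , M u ⟩ ≡ ⟨ u , F u ⟩ + r * ⟨ u , M u ⟩
    norm-M u = trans (N-sym m u (M u)) (trans (dot-congʳ u (MM u))
      (trans (dot-linearʳ 1ℤ r (F u) (M u) u) (cong (_+ r * ⟨ u , M u ⟩) (ℤ.*-identityˡ ⟨ u , F u ⟩))))

    dot-scaleʳ : ∀ a (u v : ℤVec n) → ⟨ u , (λ i → a * v i) ⟩ ≡ a * ⟨ u , v ⟩
    dot-scaleʳ a u v = trans (dot-def u (λ i → a * v i)) (trans (sum-cong-≗ λ i → swap a (u i) (v i)) (trans (sym (*-distribˡ-sum a (λ i → u i * v i))) (cong (a *_) (sym (dot-def u v)))))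
      where
      swap : ∀ a x y → x * (a * y) ≡ a * (x * y)
      swap = solve-∀

    norm-F : ∀ u → ⟨ F u , F u ⟩ ≡ + 3 * m * ⟨ u , F u ⟩
    norm-F u = trans (F-sym u (F u)) (trans (dot-congʳ u (FF u)) (dot-scaleʳ (+ 3 * m) u (F u)))

    dot-M-F : ∀ u v → ⟨ M u , F v ⟩ ≡ m * ⟨ u , F v ⟩
    dot-M-F u v = trans (N-sym m u (F v)) (trans (dot-congʳ u (N-F m v)) (dot-scaleʳ m u (F v)))

    -- Since F² = 3 m F, the form of F is the squared norm of F u divided by 3 m.
    F-nonneg : ∀ u → 0ℤ ≤ ⟨ u , F u ⟩
    F-nonneg u = nonneg-cancel (ℤ.*-monoˡ-<-pos (+ 3) 0<m) (subst (0ℤ ≤_) (norm-F u) (norm-nonneg (F u)))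

    -- On the eigenspaces of M, with eigenvalues 0, r, m, the operator 3M − F takes the values 0, 3r, 0.
    F≤3M : ∀ u → 0ℤ ≤ + 3 * ⟨ u , M u ⟩ - ⟨ u , F u ⟩
    F≤3M u = nonneg-cancel (ℤ.*-monoˡ-<-pos (+ 3) 0<r) (subst (0ℤ ≤_) norm-w (norm-nonneg w))
      where
      w : ℤVec n
      w i = + 3 * M u i + -1ℤ * F u i
      expand : ∀ r a b → + 3 * (+ 3 * (b + r * a) + -1ℤ * ((r + + 3) * b)) + -1ℤ * (+ 3 * ((r + + 3) * b) + -1ℤ * (+ 3 * (r + + 3) * b))
        ≡ + 3 * r * (+ 3 * a - b)
      expand = solve-∀
      norm-w : ⟨ w , w ⟩ ≡ + 3 * r * (+ 3 * ⟨ u , M u ⟩ - ⟨ u , F u ⟩)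
      norm-w = begin
        ⟨ w , w ⟩
          ≡⟨ dot-linearˡ (+ 3) -1ℤ (M u) (F u) w ⟩
        + 3 * ⟨ M u , w ⟩ + -1ℤ * ⟨ F u , w ⟩
          ≡⟨ cong₂ (λ x y → + 3 * x + -1ℤ * y)
               (trans (dot-linearʳ (+ 3) -1ℤ (M u) (F u) (M u))
                 (cong₂ (λ x y → + 3 * x + -1ℤ * y) (norm-M u) (dot-M-F u u)))
               (trans (dot-linearʳ (+ 3) -1ℤ (M u) (F u) (F u))
                 (cong₂ (λ x y → + 3 * x + -1ℤ * y) (trans (dot-comm (F u) (M u)) (dot-M-F u u)) (norm-F u))) ⟩
        _ ≡⟨ expand r ⟨ u , M u ⟩ ⟨ u , F u ⟩ ⟩
        + 3 * r * (+ 3 * ⟨ u , M u ⟩ - ⟨ u , F u ⟩) ∎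

    M-nonneg : ∀ u → 0ℤ ≤ ⟨ u , M u ⟩
    M-nonneg u = nonneg-cancel (+<+ {0} {3} (s≤s z≤n))
      (subst (0ℤ ≤_) (cancel (+ 3 * ⟨ u , M u ⟩) ⟨ u , F u ⟩) (ℤ.+-mono-≤ (F≤3M u) (F-nonneg u)))
      where
      cancel : ∀ x y → x - y + y ≡ x
      cancel = solve-∀

    -- If uMu = 0, then the nonnegative numbers 3 uMu - uFu and uFu add up to 0. Hence uFu = 0, and
    -- the norm of M u, which is uFu + r uMu, vanishes.
    M-definite : ∀ u → ⟨ u , M u ⟩ ≡ 0ℤ → ∀ i → M u i ≡ 0ℤ
    M-definite u uMu≡0 = norm-zero (M u) (trans (norm-M u)
      (cong₂ _+_ uFu≡0 (trans (cong (r *_) uMu≡0) (ℤ.*-zeroʳ r))))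
      where
      cancel : ∀ x y → + 3 * x - y + y ≡ + 3 * x
      cancel = solve-∀
      uFu≡0 : ⟨ u , F u ⟩ ≡ 0ℤ
      uFu≡0 = proj₂ (nonneg-sum-zero (F≤3M u) (F-nonneg u)
        (trans (cancel ⟨ u , M u ⟩ ⟨ u , F u ⟩) (cong (+ 3 *_) uMu≡0)))

    M-entry-sym : ∀ i j → M (e i) j ≡ M (e j) i
    M-entry-sym i j = trans (sym (dot-e j (M (e i)))) (trans (dot-comm (e j) (M (e i)))
      (trans (N-sym m (e i) (e j)) (dot-e i (M (e j)))))

    F-entry-sym : ∀ i j → F (e i) j ≡ F (e j) i
    F-entry-sym i j = trans (sym (dot-e j (F (e i)))) (trans (dot-comm (e j) (F (e i)))
      (trans (F-sym (e i) (e j)) (dot-e i (F (e j)))))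

    pair : Fin n → Fin n → ℤ → ℤVec n
    pair i j ε k = 1ℤ * e i k + ε * e j k

    pair-form : (G : ℤVec n → ℤVec n) → (∀ a b u v i → G (λ k → a * u k + b * v k) i ≡ a * G u i + b * G v i) →
      (∀ i j → G (e i) j ≡ G (e j) i) → ∀ i j ε →
      ⟨ pair i j ε , G (pair i j ε) ⟩ ≡ G (e i) i + ε * ε * G (e j) j + + 2 * ε * G (e i) j
    pair-form G linear symmetric i j ε = begin
      ⟨ p , G p ⟩
        ≡⟨ dot-linearˡ 1ℤ ε (e i) (e j) (G p) ⟩
      1ℤ * ⟨ e i , G p ⟩ + ε * ⟨ e j , G p ⟩
        ≡⟨ cong₂ (λ x y → 1ℤ * x + ε * y)
             (trans (dot-e i (G p)) (linear 1ℤ ε (e i) (e j) i)) (trans (dot-e j (G p)) (linear 1ℤ ε (e i) (e j) j)) ⟩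
      1ℤ * (1ℤ * G (e i) i + ε * G (e j) i) + ε * (1ℤ * G (e i) j + ε * G (e j) j)
        ≡⟨ cong (λ x → 1ℤ * (1ℤ * G (e i) i + ε * x) + ε * (1ℤ * G (e i) j + ε * G (e j) j)) (symmetric j i) ⟩
      1ℤ * (1ℤ * G (e i) i + ε * G (e i) j) + ε * (1ℤ * G (e i) j + ε * G (e j) j)
        ≡⟨ collect (G (e i) i) (G (e j) j) (G (e i) j) ε ⟩
      G (e i) i + ε * ε * G (e j) j + + 2 * ε * G (e i) j ∎
      where
      p = pair i j ε
      collect : ∀ x y z ε → 1ℤ * (1ℤ * x + ε * z) + ε * (1ℤ * z + ε * y) ≡ x + ε * ε * y + + 2 * ε * z
      collect = solve-∀

    row-sum-square : ∀ i → sum (λ k → S i k * S i k) ≡ r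
    row-sum-square i = begin
      sum (λ k → S i k * S i k)              ≡⟨ sum-cong-≗ (λ k → trans (S-square i k) (weigh (e i k))) ⟩
      sum (λ k → 1ℤ * 1ℤ + -1ℤ * e i k)      ≡⟨ sum-linear 1ℤ -1ℤ (λ _ → 1ℤ) (e i) ⟩
      1ℤ * sum (λ (_ : Fin n) → 1ℤ) + -1ℤ * sum (e i)   ≡⟨ cong₂ (λ x y → 1ℤ * x + -1ℤ * y) card (sum-e-one i) ⟩
      1ℤ * (r + 1ℤ) + -1ℤ * 1ℤ               ≡⟨ simplify r ⟩
      r                                      ∎
      where
      weigh : ∀ x → 1ℤ + - x ≡ 1ℤ * 1ℤ + -1ℤ * x
      weigh = solve-∀
      simplify : ∀ r → 1ℤ * (r + 1ℤ) + -1ℤ * 1ℤ ≡ r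
      simplify = solve-∀

    TT-entry : ∀ i j → T (T (e i)) j ≡ sum (λ k → S i k * S k j)
    TT-entry i j = trans (⊙-def (T (e i)) S j) (sum-cong-≗ λ k → cong (_* S k j) (e-⊙ S i k))

    M-diag : ∀ i → M (e i) i ≡ + 3
    M-diag i = begin
      M (e i) i                              ≡⟨ N-def m (e i) i ⟩
      T (T (e i)) i + m * e i i              ≡⟨ cong₂ (λ x y → x + m * y) (TT-entry i i) (e-diag i) ⟩
      sum (λ k → S i k * S k i) + m * 1ℤ     ≡⟨ cong (_+ m * 1ℤ) (trans (sum-cong-≗ negate) (sum-neg (λ k → S i k * S i k))) ⟩
      - sum (λ k → S i k * S i k) + m * 1ℤ   ≡⟨ cong (λ x → - x + m * 1ℤ) (row-sum-square i) ⟩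
      - r + m * 1ℤ                           ≡⟨ simplify r ⟩
      + 3                                    ∎
      where
      negate : ∀ k → S i k * S k i ≡ - (S i k * S i k)
      negate k = trans (cong (S i k *_) (skew i k)) (sym (ℤ.neg-distribʳ-* (S i k) (S i k)))
      simplify : ∀ r → - r + (r + + 3) * 1ℤ ≡ + 3
      simplify = solve-∀

    -- For odd a and b, a b ≡ 1 ≡ a² + b² − 1 mod 2, and this persists when one of them is 0.
    product-parity : ∀ i j k → i ≢ j → ∃ λ h → S i k * S k j ≡ (S i k * S i k + S j k * S j k + - 1ℤ) + + 2 * h
    product-parity i j k i≢j with i ≟ k | j ≟ k
    ... | yes refl | yes refl = contradiction refl i≢j
    ... | yes refl | no j≢k = 0ℤ , trans (cong (_* S i j) (proj₁ seidel i))
          (sym (cong₂ (λ x y → x * x + y + - 1ℤ + 0ℤ) (proj₁ seidel i) (unit-square (proj₁ (proj₂ seidel) j i j≢k))))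
    ... | no i≢k | yes refl = 0ℤ , trans (trans (cong (S i j *_) (proj₁ seidel j)) (ℤ.*-zeroʳ (S i j)))
          (sym (cong₂ (λ x y → x + y * y + - 1ℤ + 0ℤ) (unit-square (proj₁ (proj₂ seidel) i j i≢k)) (proj₁ seidel j)))
    ... | no i≢k | no j≢k = go (proj₁ (proj₂ seidel) i k i≢k) (proj₁ (proj₂ seidel) j k j≢k)
      where
      go : IsUnit (S i k) → IsUnit (S j k) → ∃ λ h → S i k * S k j ≡ (S i k * S i k + S j k * S j k + - 1ℤ) + + 2 * h
      go u v rewrite skew j k with S i k | S j k | u | v
      ... | _ | _ | inj₁ refl | inj₁ refl = -1ℤ , refl
      ... | _ | _ | inj₁ refl | inj₂ refl = 0ℤ , refl
      ... | _ | _ | inj₂ refl | inj₁ refl = 0ℤ , refl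
      ... | _ | _ | inj₂ refl | inj₂ refl = -1ℤ , refl

    M-odd : ∀ i j → i ≢ j → ∃ λ h → M (e i) j ≡ 1ℤ + + 2 * h
    -- Summing a + b - 1 over all k gives 2 r - (r + 1) = 4 τ - 1 = 1 + 2 (2 τ - 1); the quotients h
    -- add 2 Σ h.
    M-odd i j i≢j = (+ 2 * τ + - 1ℤ + sum h) , (begin
      M (e i) j
        ≡⟨ N-def m (e i) j ⟩
      T (T (e i)) j + m * e i j
        ≡⟨ cong₂ (λ x y → x + m * y) (TT-entry i j) (e-off i≢j) ⟩
      sum (λ k → S i k * S k j) + m * 0ℤ
        ≡⟨ cong (_+ m * 0ℤ) (trans (sum-cong-≗ (λ k → trans (proj₂ (product-parity i j k i≢j)) (weigh (a k) (b k) (h k))))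
             (trans (sum-linear 1ℤ 1ℤ (λ k → 1ℤ * a k + 1ℤ * b k) (λ k → -1ℤ * 1ℤ + + 2 * h k))
                    (cong₂ (λ x y → 1ℤ * x + 1ℤ * y) (sum-linear 1ℤ 1ℤ a b) (sum-linear -1ℤ (+ 2) (λ _ → 1ℤ) h)))) ⟩
      1ℤ * (1ℤ * sum a + 1ℤ * sum b) + 1ℤ * (-1ℤ * sum (λ (_ : Fin n) → 1ℤ) + + 2 * sum h) + m * 0ℤ
        ≡⟨ cong₂ (λ x y → 1ℤ * (1ℤ * x + 1ℤ * y) + 1ℤ * (-1ℤ * sum (λ (_ : Fin n) → 1ℤ) + + 2 * sum h) + m * 0ℤ)
             (row-sum-square i) (row-sum-square j) ⟩
      1ℤ * (1ℤ * r + 1ℤ * r) + 1ℤ * (-1ℤ * sum (λ (_ : Fin n) → 1ℤ) + + 2 * sum h) + m * 0ℤ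
        ≡⟨ cong (λ x → 1ℤ * (1ℤ * r + 1ℤ * r) + 1ℤ * (-1ℤ * x + + 2 * sum h) + m * 0ℤ) card ⟩
      1ℤ * (1ℤ * r + 1ℤ * r) + 1ℤ * (-1ℤ * (r + 1ℤ) + + 2 * sum h) + m * 0ℤ
        ≡⟨ cong (λ r → 1ℤ * (1ℤ * r + 1ℤ * r) + 1ℤ * (-1ℤ * (r + 1ℤ) + + 2 * sum h) + (r + + 3) * 0ℤ) r≡4τ ⟩
      1ℤ * (1ℤ * (+ 4 * τ) + 1ℤ * (+ 4 * τ)) + 1ℤ * (-1ℤ * (+ 4 * τ + 1ℤ) + + 2 * sum h) + (+ 4 * τ + + 3) * 0ℤ
        ≡⟨ simplify τ (sum h) ⟩
      1ℤ + + 2 * (+ 2 * τ + - 1ℤ + sum h) ∎)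
      where
      a b h : Fin n → ℤ
      a k = S i k * S i k
      b k = S j k * S j k
      h k = proj₁ (product-parity i j k i≢j)
      weigh : ∀ a b h → (a + b + - 1ℤ) + + 2 * h ≡ 1ℤ * (1ℤ * a + 1ℤ * b) + 1ℤ * (-1ℤ * 1ℤ + + 2 * h)
      weigh = solve-∀
      simplify : ∀ τ h → 1ℤ * (1ℤ * (+ 4 * τ) + 1ℤ * (+ 4 * τ)) + 1ℤ * (-1ℤ * (+ 4 * τ + 1ℤ) + + 2 * h) + (+ 4 * τ + + 3) * 0ℤ
        ≡ 1ℤ + + 2 * (+ 2 * τ + - 1ℤ + h)
      simplify = solve-∀

    M-pair : ∀ i j ε → IsUnit ε → ⟨ pair i j ε , M (pair i j ε) ⟩ ≡ + 6 + + 2 * ε * M (e i) j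
    M-pair i j ε u = trans (pair-form M (N-linear m) M-entry-sym i j ε)
      (cong (_+ + 2 * ε * M (e i) j) (trans (cong₂ (λ x y → x + ε * ε * y) (M-diag i) (M-diag j))
        (cong (λ x → + 3 + x * + 3) (unit-square u))))

    M-small : ∀ i j → Small (M (e i) j)
    M-small i j = go (i ≟ j)
      where
      go : Dec (i ≡ j) → Small (M (e i) j)
      go (yes refl) = subst Small (sym (M-diag i)) (triple (inj₁ refl))
      go (no i≢j) with M-odd i j i≢j
      ... | h , odd = subst Small (sym odd) (odd-bounded h
              (subst (λ z → 0ℤ ≤ + 6 + + 2 * z) odd (subst (0ℤ ≤_) (M-pair i j 1ℤ (inj₁ refl)) (M-nonneg (pair i j 1ℤ))))
              (subst (λ z → 0ℤ ≤ + 6 + - + 2 * z) odd (subst (0ℤ ≤_) (M-pair i j -1ℤ (inj₂ refl)) (M-nonneg (pair i j -1ℤ)))))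

    -- The vector e_i - ε e_j has form value 6 - 6 ε² = 0, so semidefiniteness puts it in the kernel
    -- of M.
    M-parallel : ∀ i j ε → IsUnit ε → M (e i) j ≡ + 3 * ε → ∀ k → M (e i) k ≡ ε * M (e j) k
    M-parallel i j ε u Mij≡3ε k = begin
      M (e i) k                                                ≡⟨ split (M (e i) k) (M (e j) k) ε ⟩
      (1ℤ * M (e i) k + - ε * M (e j) k) + ε * M (e j) k       ≡⟨ cong (_+ ε * M (e j) k) (N-linear m 1ℤ (- ε) (e i) (e j) k) ⟨
      M (pair i j (- ε)) k + ε * M (e j) k                     ≡⟨ cong (_+ ε * M (e j) k) (M-definite (pair i j (- ε)) null k) ⟩
      0ℤ + ε * M (e j) k                                       ≡⟨ ℤ.+-identityˡ _ ⟩
      ε * M (e j) k                                            ∎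
      where
      split : ∀ x y ε → x ≡ (1ℤ * x + - ε * y) + ε * y
      split = solve-∀
      regroup : ∀ ε → + 6 + + 2 * - ε * (+ 3 * ε) ≡ + 6 + - + 6 * (ε * ε)
      regroup = solve-∀
      null : ⟨ pair i j (- ε) , M (pair i j (- ε)) ⟩ ≡ 0ℤ
      null = trans (M-pair i j (- ε) (unit-neg u)) (trans (cong (λ z → + 6 + + 2 * - ε * z) Mij≡3ε)
        (trans (regroup ε) (cong (λ z → + 6 + - + 6 * z) (unit-square u))))

    -- The diagonal of F and the classes of parallel rows of M

    g : Fin n → Fin n → ℤ
    g i k = level (M-small i k)

    -- The sum counts the entries ±3 in row i, that is the rows parallel to row i, itself included;
    -- d is the excess of this count over τ.
    d : Fin n → ℤ
    d i = sum (g i) + - τ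

    -- The squared norm of row i of M is F_ii + 3 r by M² = F + r M, and r + 1 + 8 Σ g entry by
    -- entry. With r = 4 τ the difference is 8 (Σ g - τ) + 1.
    F-diag : ∀ i → F (e i) i ≡ + 8 * d i + 1ℤ
    F-diag i = begin
      F (e i) i
        ≡⟨ split (F (e i) i) (r * + 3) ⟩
      (F (e i) i + r * + 3) + - (r * + 3)
        ≡⟨ cong (_+ - (r * + 3)) (trans (sym (dot-def (M (e i)) (M (e i)))) (trans (norm-M (e i)) (cong₂ (λ x y → x + r * y) (dot-e i (F (e i))) (trans (dot-e i (M (e i))) (M-diag i))))) ⟨
      sum (λ k → M (e i) k * M (e i) k) + - (r * + 3)
        ≡⟨ cong (_+ - (r * + 3)) (trans (sum-cong-≗ λ k → trans (small-square (M-small i k)) (weigh (g i k)))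
             (trans (sum-linear 1ℤ (+ 8) (λ _ → 1ℤ) (g i)) (cong (λ x → 1ℤ * x + + 8 * sum (g i)) card))) ⟩
      1ℤ * (r + 1ℤ) + + 8 * sum (g i) + - (r * + 3)
        ≡⟨ cong (λ r → 1ℤ * (r + 1ℤ) + + 8 * sum (g i) + - (r * + 3)) r≡4τ ⟩
      1ℤ * (+ 4 * τ + 1ℤ) + + 8 * sum (g i) + - (+ 4 * τ * + 3)
        ≡⟨ simplify τ (sum (g i)) ⟩
      + 8 * d i + 1ℤ ∎
      where
      split : ∀ x y → x ≡ (x + y) + - y
      split = solve-∀
      weigh : ∀ x → 1ℤ + + 8 * x ≡ 1ℤ * 1ℤ + + 8 * x
      weigh = solve-∀
      simplify : ∀ τ c → 1ℤ * (+ 4 * τ + 1ℤ) + + 8 * c + - (+ 4 * τ * + 3) ≡ + 8 * (c + - τ) + 1ℤ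
      simplify = solve-∀

    F-diag-nonneg : ∀ i → 0ℤ ≤ F (e i) i
    F-diag-nonneg i = subst (0ℤ ≤_) (dot-e i (F (e i))) (F-nonneg (e i))

    d-nonneg : ∀ i → 0ℤ ≤ d i
    d-nonneg i = go (d i) (subst (0ℤ ≤_) (F-diag i) (F-diag-nonneg i))
      where
      identity : ∀ k → + 8 * (- (1ℤ + k)) + 1ℤ + + 8 * k ≡ - + 7
      identity = solve-∀
      go : ∀ d → 0ℤ ≤ + 8 * d + 1ℤ → 0ℤ ≤ d
      go (+ d) _ = +≤+ z≤n
      go -[1+ k ] p = ⊥-elim (absurd-nonneg (ℤ.+-mono-≤ p (ℤ.*-monoˡ-≤-nonNeg (+ 8) (+≤+ (z≤n {k})))) (identity (+ k)))

    -- F_ii times row j minus F_ij times row i is a kernel vector that vanishes at i, hence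
    -- everywhere; its entry at j is the claim.
    F-rank-one : ∀ i j → F (e i) j * F (e i) j ≡ F (e i) i * F (e j) j
    F-rank-one i j = sym (begin
      F (e i) i * F (e j) j
        ≡⟨ split (F (e i) i * F (e j) j) (F (e i) j) ⟩
      (F (e i) i * F (e j) j + - F (e i) j * F (e i) j) + F (e i) j * F (e i) j
        ≡⟨ cong (_+ F (e i) j * F (e i) j) (kernel-vanishes w Tw≡0 i wi≡0 j) ⟩
      0ℤ + F (e i) j * F (e i) j
        ≡⟨ ℤ.+-identityˡ _ ⟩
      F (e i) j * F (e i) j ∎)
      where
      split : ∀ x y → x ≡ (x + - y * y) + y * y
      split = solve-∀
      cancel : ∀ x y → x * y + - y * x ≡ 0ℤ
      cancel = solve-∀
      w : ℤVec n
      w k = F (e i) i * F (e j) k + - F (e i) j * F (e i) k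
      Tw≡0 : ∀ k → T w k ≡ 0ℤ
      Tw≡0 k = trans (T-linear (F (e i) i) (- F (e i) j) (F (e j)) (F (e i)) k)
        (cong₂ _+_ (trans (cong (F (e i) i *_) (TF (e j) k)) (ℤ.*-zeroʳ (F (e i) i)))
                   (trans (cong (- F (e i) j *_) (TF (e i) k)) (ℤ.*-zeroʳ (- F (e i) j))))
      wi≡0 : w i ≡ 0ℤ
      wi≡0 = trans (cong (λ x → F (e i) i * x + - F (e i) j * F (e i) i) (F-entry-sym j i)) (cancel (F (e i) i) (F (e i) j))

    -- By rank one, F_oo times the trace is the squared norm of row o, which is 3 m F_oo. The factor
    -- F_oo = 8 d_o + 1 is nonzero and cancels.
    trace-F : sum (λ j → F (e j) j) ≡ + 3 * m
    trace-F = ℤ.*-cancelˡ-≡ (F (e o) o) _ _ {{ℤ.≢-nonZero Foo≢0}} (begin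
      F (e o) o * sum (λ j → F (e j) j)     ≡⟨ *-distribˡ-sum (F (e o) o) (λ j → F (e j) j) ⟩
      sum (λ j → F (e o) o * F (e j) j)     ≡⟨ sum-cong-≗ (F-rank-one o) ⟨
      sum (λ j → F (e o) j * F (e o) j)     ≡⟨ dot-def (F (e o)) (F (e o)) ⟨
      ⟨ F (e o) , F (e o) ⟩                 ≡⟨ norm-F (e o) ⟩
      + 3 * m * ⟨ e o , F (e o) ⟩           ≡⟨ cong (+ 3 * m *_) (dot-e o (F (e o))) ⟩
      + 3 * m * F (e o) o                   ≡⟨ ℤ.*-comm (+ 3 * m) _ ⟩
      F (e o) o * (+ 3 * m)                 ∎)
      where
      Foo≢0 : F (e o) o ≢ 0ℤ
      Foo≢0 p = go (d-nonneg o) (trans (sym (F-diag o)) p)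
        where
        go : ∀ {d} → 0ℤ ≤ d → + 8 * d + 1ℤ ≢ 0ℤ
        go {+ suc d} _ ()

    sum-d : sum d ≡ τ + 1ℤ
    sum-d = ℤ.*-cancelˡ-≡ (+ 8) _ _ (begin
      + 8 * sum d                                         ≡⟨ split (+ 8 * sum d) (r + 1ℤ) ⟩
      (+ 8 * sum d + 1ℤ * (r + 1ℤ)) + - (r + 1ℤ)          ≡⟨ cong (_+ - (r + 1ℤ)) total ⟩
      + 3 * m + - (r + 1ℤ)                                ≡⟨ cong (λ r → + 3 * (r + + 3) + - (r + 1ℤ)) r≡4τ ⟩
      + 3 * (+ 4 * τ + + 3) + - (+ 4 * τ + 1ℤ)            ≡⟨ simplify τ ⟩
      + 8 * (τ + 1ℤ)                                      ∎)
      where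
      split : ∀ x y → x ≡ (x + 1ℤ * y) + - y
      split = solve-∀
      simplify : ∀ τ → + 3 * (+ 4 * τ + + 3) + - (+ 4 * τ + 1ℤ) ≡ + 8 * (τ + 1ℤ)
      simplify = solve-∀
      total : + 8 * sum d + 1ℤ * (r + 1ℤ) ≡ + 3 * m
      total = begin
        + 8 * sum d + 1ℤ * (r + 1ℤ)                          ≡⟨ cong (λ x → + 8 * sum d + 1ℤ * x) card ⟨
        + 8 * sum d + 1ℤ * sum (λ (_ : Fin n) → 1ℤ)          ≡⟨ sum-linear (+ 8) 1ℤ d (λ _ → 1ℤ) ⟨
        sum (λ k → + 8 * d k + 1ℤ)                           ≡⟨ sum-cong-≗ F-diag ⟨
        sum (λ k → F (e k) k)                                ≡⟨ trace-F ⟩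
        + 3 * m                                              ∎

    τ-1-nonneg : 0ℤ ≤ τ - 1ℤ
    τ-1-nonneg = ℤ.i≤j⇒0≤j-i 1≤τ

    unit-square-cancel : ∀ {ε} x → IsUnit ε → ε * x * (ε * x) ≡ x * x
    unit-square-cancel x (inj₁ refl) = cong (λ y → y * y) (ℤ.*-identityˡ x)
    unit-square-cancel x (inj₂ refl) = identity x
      where
      identity : ∀ x → -1ℤ * x * (-1ℤ * x) ≡ x * x
      identity = solve-∀

    norm-M-entry : ∀ i → ⟨ M (e i) , M (e i) ⟩ ≡ + 8 * d i + 1ℤ + r * + 3
    norm-M-entry i = trans (norm-M (e i)) (cong₂ (λ x y → x + r * y)
      (trans (dot-e i (F (e i))) (F-diag i)) (trans (dot-e i (M (e i))) (M-diag i)))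

    -- Rows equal up to sign have the same norm, and the norm of row i of M determines d_i.
    parallel⇒d≡ : ∀ i j ε → IsUnit ε → M (e i) j ≡ + 3 * ε → d i ≡ d j
    parallel⇒d≡ i j ε u Mij≡3ε = ℤ.*-cancelˡ-≡ (+ 8) (d i) (d j) (begin
      + 8 * d i                                                  ≡⟨ split (+ 8 * d i) r ⟩
      (+ 8 * d i + 1ℤ + r * + 3) + - (1ℤ + r * + 3)              ≡⟨ cong (_+ - (1ℤ + r * + 3)) same ⟩
      (+ 8 * d j + 1ℤ + r * + 3) + - (1ℤ + r * + 3)              ≡⟨ split (+ 8 * d j) r ⟨
      + 8 * d j                                                  ∎)
      where
      split : ∀ x r → x ≡ (x + 1ℤ + r * + 3) + - (1ℤ + r * + 3)
      split = solve-∀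
      same : + 8 * d i + 1ℤ + r * + 3 ≡ + 8 * d j + 1ℤ + r * + 3
      same = trans (sym (norm-M-entry i)) (trans (trans (dot-def (M (e i)) (M (e i))) (trans
        (sum-cong-≗ λ k → trans (cong (λ x → x * x) (M-parallel i j ε u Mij≡3ε k)) (unit-square-cancel (M (e j) k) u))
        (sym (dot-def (M (e j)) (M (e j))))))
        (norm-M-entry j))

    -- The d_a + τ rows parallel to row a all have the value d_a, every other d_k is nonnegative,
    -- and the total is τ + 1.
    class-weight : ∀ a → (d a + τ) * d a ≤ τ + 1ℤ
    class-weight a = ℤ.≤-trans (ℤ.≤-reflexive total) (ℤ.≤-trans (sum-mono termwise) (ℤ.≤-reflexive sum-d))
      where
      total : (d a + τ) * d a ≡ sum (λ k → g a k * d a)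
      total = trans (cong (_* d a) (cancel (sum (g a)) τ)) (*-distribʳ-sum (d a) (g a))
        where
        cancel : ∀ x τ → x + - τ + τ ≡ x
        cancel = solve-∀
      termwise : ∀ k → g a k * d a ≤ d k
      termwise k = go (M-small a k) refl
        where
        go : ∀ {z} (s : Small z) → z ≡ M (e a) k → level s * d a ≤ d k
        go (unit _) _ = subst (_≤ d k) (sym (ℤ.*-zeroˡ (d a))) (d-nonneg k)
        go (triple {ε} u) p = ℤ.≤-reflexive (trans (ℤ.*-identityˡ (d a)) (parallel⇒d≡ a k ε u (sym p)))

    d≤1 : ∀ a → d a ≡ 0ℤ ⊎ d a ≡ 1ℤ
    d≤1 a = go (d a) (d-nonneg a) (class-weight a)
      where
      -- With d_a = 2 + k the bound of `class-weight` fails: its slack plus terms that are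
      -- nonnegative for τ ≥ 1 is -4.
      identity : ∀ τ k → (τ + 1ℤ - (+ 2 + k + τ) * (+ 2 + k)) + (k * k + k * (τ - 1ℤ) + (τ - 1ℤ) + + 5 * k) ≡ - + 4
      identity = solve-∀
      go : ∀ x → 0ℤ ≤ x → (x + τ) * x ≤ τ + 1ℤ → x ≡ 0ℤ ⊎ x ≡ 1ℤ
      go (+ 0) _ _ = inj₁ refl
      go (+ 1) _ _ = inj₂ refl
      go (+ suc (suc k)) _ p = ⊥-elim (absurd-nonneg
        (ℤ.+-mono-≤ (ℤ.i≤j⇒0≤j-i p)
          (ℤ.+-mono-≤ (ℤ.+-mono-≤ (ℤ.+-mono-≤ (square-nonneg (+ k))
            (subst (_≤ + k * (τ - 1ℤ)) (ℤ.*-zeroʳ (+ k)) (ℤ.*-monoˡ-≤-nonNeg (+ k) τ-1-nonneg))) τ-1-nonneg) (ℤ.*-monoˡ-≤-nonNeg (+ 5) (+≤+ (z≤n {k})))))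
        (identity τ (+ k)))

    heavy : ∃ λ a → d a ≡ 1ℤ
    heavy = let a , da≢0 = ¬∀⟶∃¬ n (λ i → d i ≡ 0ℤ) (λ i → d i ℤ.≟ 0ℤ) not-all-zero
            in a , fromInj₂ (λ da≡0 → contradiction da≡0 da≢0) (d≤1 a)
      where
      shift : ∀ τ → τ - 1ℤ ≡ τ + 1ℤ + - + 2
      shift = solve-∀
      not-all-zero : ¬ (∀ i → d i ≡ 0ℤ)
      not-all-zero all-zero = absurd-nonneg τ-1-nonneg
        (trans (shift τ) (cong (_+ - + 2) (trans (sym sum-d) (Dℤ.sum-zero all-zero))))

    light : ∃ λ b → d b ≡ 0ℤ
    light = let b , db≢1 = ¬∀⟶∃¬ n (λ i → d i ≡ 1ℤ) (λ i → d i ℤ.≟ 1ℤ) not-all-one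
            in b , fromInj₁ (λ db≡1 → contradiction db≡1 db≢1) (d≤1 b)
      where
      identity : ∀ τ → τ + 1ℤ ≡ + 4 * τ + 1ℤ → + 3 * (τ - 1ℤ) ≡ - + 3
      identity τ p = trans (expand τ) (trans (cong (λ x → x + - (τ + 1ℤ) + - + 3) (sym p)) (collapse τ))
        where
        expand : ∀ τ → + 3 * (τ - 1ℤ) ≡ + 4 * τ + 1ℤ + - (τ + 1ℤ) + - + 3
        expand = solve-∀
        collapse : ∀ τ → τ + 1ℤ + - (τ + 1ℤ) + - + 3 ≡ - + 3
        collapse = solve-∀
      not-all-one : ¬ (∀ i → d i ≡ 1ℤ)
      -- If all d_i were 1, their sum τ + 1 would equal the order 4 τ + 1, against τ ≥ 1.
      not-all-one all-one = absurd-nonneg (ℤ.*-monoˡ-≤-nonNeg (+ 3) τ-1-nonneg)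
        (identity τ (trans (sym sum-d) (trans (sum-cong-≗ all-one) (trans card (cong (_+ 1ℤ) r≡4τ)))))

    -- Construction of the bordering vector

    Trit : ℤ → Set
    Trit x = x ≡ 0ℤ ⊎ IsUnit x

    half-difference : ∀ {ε δ δ′} → IsUnit ε → IsUnit δ → IsUnit δ′ → ∃ λ x → 1ℤ * δ + - ε * δ′ ≡ + 2 * x × Trit x
    half-difference (inj₁ refl) (inj₁ refl) (inj₁ refl) = 0ℤ , refl , inj₁ refl
    half-difference (inj₁ refl) (inj₁ refl) (inj₂ refl) = 1ℤ , refl , inj₂ (inj₁ refl)
    half-difference (inj₁ refl) (inj₂ refl) (inj₁ refl) = -1ℤ , refl , inj₂ (inj₂ refl)
    half-difference (inj₁ refl) (inj₂ refl) (inj₂ refl) = 0ℤ , refl , inj₁ refl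
    half-difference (inj₂ refl) (inj₁ refl) (inj₁ refl) = 1ℤ , refl , inj₂ (inj₁ refl)
    half-difference (inj₂ refl) (inj₁ refl) (inj₂ refl) = 0ℤ , refl , inj₁ refl
    half-difference (inj₂ refl) (inj₂ refl) (inj₁ refl) = 0ℤ , refl , inj₁ refl
    half-difference (inj₂ refl) (inj₂ refl) (inj₂ refl) = -1ℤ , refl , inj₂ (inj₂ refl)

    half-parallelˡ : ∀ {ε δ} → IsUnit ε → IsUnit δ → ∃ λ x → 1ℤ * (+ 3 * δ) + - ε * (δ * ε) ≡ + 2 * x × Trit x
    half-parallelˡ {ε} {δ} u v = δ , trans (regroup ε δ) (trans (cong (λ z → + 3 * δ + - (z * δ)) (unit-square u)) (simplify δ)) , inj₂ v
      where
      regroup : ∀ ε δ → 1ℤ * (+ 3 * δ) + - ε * (δ * ε) ≡ + 3 * δ + - (ε * ε * δ)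
      regroup = solve-∀
      simplify : ∀ δ → + 3 * δ + - (1ℤ * δ) ≡ + 2 * δ
      simplify = solve-∀

    unit-* : ∀ {ε δ} → IsUnit ε → IsUnit δ → IsUnit (ε * δ)
    unit-* (inj₁ refl) (inj₁ refl) = inj₁ refl
    unit-* (inj₁ refl) (inj₂ refl) = inj₂ refl
    unit-* (inj₂ refl) (inj₁ refl) = inj₂ refl
    unit-* (inj₂ refl) (inj₂ refl) = inj₁ refl

    half-parallelʳ : ∀ {ε δ} → IsUnit ε → IsUnit δ → ∃ λ x → 1ℤ * (δ * ε) + - ε * (+ 3 * δ) ≡ + 2 * x × Trit x
    half-parallelʳ {ε} {δ} u v = - (ε * δ) , regroup ε δ , inj₂ (unit-neg (unit-* u v))
      where
      regroup : ∀ ε δ → 1ℤ * (δ * ε) + - ε * (+ 3 * δ) ≡ + 2 * - (ε * δ)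
      regroup = solve-∀

    -- Rows a and k agree up to the sign δ, and symmetry of M transports this to the entry in row b.
    parallel-value : ∀ a b k {δ} → IsUnit δ → M (e a) k ≡ + 3 * δ → M (e b) k ≡ δ * M (e a) b
    parallel-value a b k {δ} u p = begin
      M (e b) k                ≡⟨ M-entry-sym b k ⟩
      M (e k) b                ≡⟨ ℤ.*-identityˡ _ ⟨
      1ℤ * M (e k) b           ≡⟨ cong (_* M (e k) b) (unit-square u) ⟨
      δ * δ * M (e k) b        ≡⟨ ℤ.*-assoc δ δ _ ⟩
      δ * (δ * M (e k) b)      ≡⟨ cong (δ *_) (M-parallel a k δ u p b) ⟨
      δ * M (e a) b            ∎

    halves : ∀ a b ε → IsUnit ε → M (e a) b ≡ ε → ∀ k → ∃ λ x → M (pair a b (- ε)) k ≡ + 2 * x × Trit x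
    halves a b ε u Mab≡ε k =
      let x , p , t = go (M-small a k) refl (M-small b k) refl
      in x , trans (N-linear m 1ℤ (- ε) (e a) (e b) k) p , t
      where
      go : ∀ {y z} → Small y → y ≡ M (e a) k → Small z → z ≡ M (e b) k →
        ∃ λ x → 1ℤ * M (e a) k + - ε * M (e b) k ≡ + 2 * x × Trit x
      -- Whatever is recorded for row b, its entry must be δ ε, so the combination is 3 δ - ε² δ = 2
      -- δ.
      go (triple {δ} v) p s q =
        let x , h , t = half-parallelˡ u v
        in x , trans (cong₂ (λ y z → 1ℤ * y + - ε * z) (sym p) (trans (parallel-value a b k v (sym p)) (cong (δ *_) Mab≡ε))) h , t
      go (unit v) p (unit w) q =
        let x , h , t = half-difference u v w
        in x , trans (cong₂ (λ y z → 1ℤ * y + - ε * z) (sym p) (sym q)) h , t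
      go (unit v) p (triple {δ} w) q =
        let x , h , t = half-parallelʳ u w
        in x , trans (cong₂ (λ y z → 1ℤ * y + - ε * z)
                 (trans (parallel-value b a k w (sym q)) (cong (δ *_) (trans (M-entry-sym b a) Mab≡ε))) (sym q)) h , t

    module Extension (a b : Fin n) (da≡1 : d a ≡ 1ℤ) (db≡0 : d b ≡ 0ℤ) where

      Faa : F (e a) a ≡ + 9
      Faa = trans (F-diag a) (cong (λ x → + 8 * x + 1ℤ) da≡1)

      Fbb : F (e b) b ≡ 1ℤ
      Fbb = trans (F-diag b) (cong (λ x → + 8 * x + 1ℤ) db≡0)

      ε : ℤ
      ε = M (e a) b

      -- An entry ±3 would make rows a and b parallel and force d_a = d_b.
      ε-unit : IsUnit ε
      ε-unit = go (M-small a b) refl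
        where
        go : ∀ {z} → Small z → z ≡ ε → IsUnit ε
        go (unit u) p = subst IsUnit p u
        go (triple {δ} u) p = contradiction (trans (sym da≡1) (trans (parallel⇒d≡ a b δ u (sym p)) db≡0)) λ ()

      u : ℤVec n
      u = pair a b (- ε)

      x : ℤVec n
      x k = proj₁ (halves a b ε ε-unit refl k)

      Mu≡2x : ∀ k → M u k ≡ + 2 * x k
      Mu≡2x k = proj₁ (proj₂ (halves a b ε ε-unit refl k))

      x-trit : ∀ k → Trit (x k)
      x-trit k = proj₂ (proj₂ (halves a b ε ε-unit refl k))

      uMu : ⟨ u , M u ⟩ ≡ + 4
      uMu = trans (M-pair a b (- ε) (unit-neg ε-unit)) (value ε-unit)
        where
        value : ∀ {ε} → IsUnit ε → + 6 + + 2 * - ε * ε ≡ + 4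
        value (inj₁ refl) = refl
        value (inj₂ refl) = refl

      uFu : ⟨ u , F u ⟩ ≡ + 10 + - + 2 * (ε * F (e a) b)
      uFu = trans (pair-form F F-linear F-entry-sym a b (- ε))
        (trans (cong₂ (λ x y → x + - ε * - ε * y + + 2 * - ε * F (e a) b) Faa Fbb)
          (trans (cong (λ z → + 9 + z * 1ℤ + + 2 * - ε * F (e a) b) (unit-square (unit-neg ε-unit))) (regroup ε (F (e a) b))))
        where
        regroup : ∀ ε f → + 9 + 1ℤ * 1ℤ + + 2 * - ε * f ≡ + 10 + - + 2 * (ε * f)
        regroup = solve-∀

      -- Both sides are the squared norm of M u = 2 x, the right one through M² = F + r M and uMu =
      -- 4.
      4xx : + 4 * ⟨ x , x ⟩ ≡ ⟨ u , F u ⟩ + r * + 4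
      4xx = begin
        + 4 * ⟨ x , x ⟩                          ≡⟨ trans (cong (+ 4 *_) (dot-def x x)) (*-distribˡ-sum (+ 4) (λ k → x k * x k)) ⟩
        sum (λ k → + 4 * (x k * x k))            ≡⟨ sum-cong-≗ (λ k → trans (cong₂ _*_ (Mu≡2x k) (Mu≡2x k)) (double (x k))) ⟨
        sum (λ k → M u k * M u k)                ≡⟨ dot-def (M u) (M u) ⟨
        ⟨ M u , M u ⟩                            ≡⟨ norm-M u ⟩
        ⟨ u , F u ⟩ + r * ⟨ u , M u ⟩            ≡⟨ cong (λ z → ⟨ u , F u ⟩ + r * z) uMu ⟩
        ⟨ u , F u ⟩ + r * + 4                    ∎
        where
        double : ∀ x → + 2 * x * (+ 2 * x) ≡ + 4 * (x * x)
        double = solve-∀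

      -- Indicator of the zeros of x; its sum, the number of zeros, must turn out to be 0.
      defect : Fin n → ℤ
      defect k = 1ℤ + - (x k * x k)

      defect-nonneg : ∀ k → 0ℤ ≤ defect k
      defect-nonneg k = go (x-trit k)
        where
        go : ∀ {x} → Trit x → 0ℤ ≤ 1ℤ + - (x * x)
        go (inj₁ refl) = +≤+ z≤n
        go (inj₂ (inj₁ refl)) = +≤+ z≤n
        go (inj₂ (inj₂ refl)) = +≤+ z≤n

      sum-defect : sum defect ≡ r + 1ℤ + - ⟨ x , x ⟩
      sum-defect = trans (∑-distrib-+ (λ _ → 1ℤ) (λ k → - (x k * x k))) (cong₂ _+_ card (trans (sum-neg (λ k → x k * x k)) (cong -_ (sym (dot-def x x)))))

      4defect : + 4 * sum defect ≡ + 4 + - ⟨ u , F u ⟩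
      4defect = trans (cong (+ 4 *_) sum-defect) (trans (expand r ⟨ x , x ⟩)
        (trans (cong (λ z → + 4 * r + + 4 + - z) 4xx) (simplify r ⟨ u , F u ⟩)))
        where
        expand : ∀ r x → + 4 * (r + 1ℤ + - x) ≡ + 4 * r + + 4 + - (+ 4 * x)
        expand = solve-∀
        simplify : ∀ r f → + 4 * r + + 4 + - (f + r * + 4) ≡ + 4 + - f
        simplify = solve-∀

      -- Rank one gives F_ab² = 9 · 1. The value -3 would mean uFu = 16, making four times the
      -- number of zeros equal to 4 - 16.
      F-ab-value : ε * F (e a) b ≡ + 3
      F-ab-value = go square bound
        where
        square : ε * F (e a) b * (ε * F (e a) b) ≡ + 9
        square = trans (unit-square-cancel (F (e a) b) ε-unit) (trans (F-rank-one a b) (cong₂ _*_ Faa Fbb))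
        bound : 0ℤ ≤ + 4 + - (+ 10 + - + 2 * (ε * F (e a) b))
        bound = subst (0ℤ ≤_) (trans 4defect (cong (λ z → + 4 + - z) uFu))
          (ℤ.*-monoˡ-≤-nonNeg (+ 4) (sum-nonneg defect-nonneg))
        go : ∀ {z} → z * z ≡ + 9 → 0ℤ ≤ + 4 + - (+ 10 + - + 2 * z) → z ≡ + 3
        go {+ 3} _ _ = refl
        go {+ 0} () _
        go {+ 1} () _
        go {+ 2} () _
        go {+ suc (suc (suc (suc z)))} p _ = ⊥-elim (absurd-nonneg
          (ℤ.+-mono-≤ (square-nonneg (+ z)) (ℤ.*-monoˡ-≤-nonNeg (+ 8) (+≤+ (z≤n {z}))))
          (trans (excess (+ z)) (cong (_+ - + 16) p)))
          where
          excess : ∀ z → z * z + + 8 * z ≡ (+ 4 + z) * (+ 4 + z) + - + 16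
          excess = solve-∀
        go { -[1+ z ] } _ p = ⊥-elim (absurd-nonneg (ℤ.+-mono-≤ p (ℤ.*-monoˡ-≤-nonNeg (+ 2) (+≤+ (z≤n {z})))) (identity (+ z)))
          where
          identity : ∀ z → + 4 + - (+ 10 + - + 2 * (- (1ℤ + z))) + + 2 * z ≡ - + 8
          identity = solve-∀

      uFu≡4 : ⟨ u , F u ⟩ ≡ + 4
      uFu≡4 = trans uFu (cong (λ z → + 10 + - + 2 * z) F-ab-value)

      x-unit : ∀ k → IsUnit (x k)
      x-unit k = go (x-trit k) (sum-nonneg-zero defect-nonneg sum-defect≡0 k)
        where
        sum-defect≡0 : sum defect ≡ 0ℤ
        sum-defect≡0 = ℤ.*-cancelˡ-≡ (+ 4) (sum defect) 0ℤ (trans 4defect (cong (λ z → + 4 + - z) uFu≡4))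
        go : ∀ {x} → Trit x → 1ℤ + - (x * x) ≡ 0ℤ → IsUnit x
        go (inj₁ refl) ()
        go (inj₂ v) _ = v

      xx : ⟨ x , x ⟩ ≡ r + 1ℤ
      xx = trans (dot-def x x) (trans (sum-cong-≗ λ k → unit-square (x-unit k)) card)

      M-x : ∀ k → + 2 * M x k ≡ M (M u) k
      M-x k = trans (sym (N-scale m (+ 2) x k)) (M-cong (sym ∘ Mu≡2x) k)

      -- After substituting 2 x = M u and M² = F + r M, only the two numbers uFu = 4 and uMu = 4
      -- remain.
      xMx : ⟨ x , M x ⟩ ≡ m + r * (1ℤ + r)
      xMx = ℤ.*-cancelˡ-≡ (+ 4) _ _ (begin
        + 4 * ⟨ x , M x ⟩
          ≡⟨ trans (cong (+ 4 *_) (dot-def x (M x))) (*-distribˡ-sum (+ 4) (λ k → x k * M x k)) ⟩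
        sum (λ k → + 4 * (x k * M x k))
          ≡⟨ sum-cong-≗ (λ k → trans (double (x k) (M x k)) (cong₂ _*_ (sym (Mu≡2x k)) (M-x k))) ⟩
        sum (λ k → M u k * M (M u) k)
          ≡⟨ dot-def (M u) (M (M u)) ⟨
        ⟨ M u , M (M u) ⟩
          ≡⟨ dot-congʳ (M u) (MM u) ⟩
        ⟨ M u , (λ k → 1ℤ * F u k + r * M u k) ⟩
          ≡⟨ dot-linearʳ 1ℤ r (F u) (M u) (M u) ⟩
        1ℤ * ⟨ M u , F u ⟩ + r * ⟨ M u , M u ⟩
          ≡⟨ cong₂ (λ y z → 1ℤ * y + r * z) (trans (dot-M-F u u) (cong (m *_) uFu≡4))
               (trans (norm-M u) (cong₂ (λ y z → y + r * z) uFu≡4 uMu)) ⟩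
        1ℤ * (m * + 4) + r * (+ 4 + r * + 4)
          ≡⟨ simplify m r ⟩
        + 4 * (m + r * (1ℤ + r)) ∎)
        where
        double : ∀ x y → + 4 * (x * y) ≡ + 2 * x * (+ 2 * y)
        double = solve-∀
        simplify : ∀ m r → 1ℤ * (m * + 4) + r * (+ 4 + r * + 4) ≡ + 4 * (m + r * (1ℤ + r))
        simplify = solve-∀

      -- S² = M - m leaves m + r (1 + r) - m (r + 1). This is the constant that later makes the
      -- corner polynomial factor.
      xTTx : ⟨ x , T (T x) ⟩ ≡ - + 2 * r
      xTTx = begin
        ⟨ x , T (T x) ⟩
          ≡⟨ split ⟨ x , T (T x) ⟩ (m * ⟨ x , x ⟩) ⟩
        (⟨ x , T (T x) ⟩ + m * ⟨ x , x ⟩) + - (m * ⟨ x , x ⟩)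
          ≡⟨ cong₂ (λ y z → y + - (m * z)) (trans (sym M-expand) xMx) xx ⟩
        m + r * (1ℤ + r) + - (m * (r + 1ℤ))
          ≡⟨ simplify r ⟩
        - + 2 * r ∎
        where
        split : ∀ x y → x ≡ (x + y) + - y
        split = solve-∀
        simplify : ∀ r → r + + 3 + r * (1ℤ + r) + - ((r + + 3) * (r + 1ℤ)) ≡ - + 2 * r
        simplify = solve-∀
        M-expand : ⟨ x , M x ⟩ ≡ ⟨ x , T (T x) ⟩ + m * ⟨ x , x ⟩
        M-expand = begin
          ⟨ x , M x ⟩
            ≡⟨ dot-congʳ x (λ k → trans (N-def m x k) (cong (_+ m * x k) (sym (ℤ.*-identityˡ (T (T x) k))))) ⟩
          ⟨ x , (λ k → 1ℤ * T (T x) k + m * x k) ⟩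
            ≡⟨ dot-linearʳ 1ℤ m (T (T x)) x x ⟩
          1ℤ * ⟨ x , T (T x) ⟩ + m * ⟨ x , x ⟩
            ≡⟨ cong (_+ m * ⟨ x , x ⟩) (ℤ.*-identityˡ ⟨ x , T (T x) ⟩) ⟩
          ⟨ x , T (T x) ⟩ + m * ⟨ x , x ⟩ ∎

      -- Twice the left side is S (S² + 3) M u = S F u, and the image of F lies in the kernel of S.
      TTTx : ∀ k → T (T (T x)) k + + 3 * T x k ≡ 0ℤ
      TTTx k = trans (sym (N-def (+ 3) (T x) k)) (ℤ.*-cancelˡ-≡ (+ 2) (N (+ 3) (T x) k) 0ℤ (begin
        + 2 * N (+ 3) (T x) k            ≡⟨ N-scale (+ 3) (+ 2) (T x) k ⟨
        N (+ 3) (λ j → + 2 * T x j) k    ≡⟨ N-cong (+ 3) (λ j → trans (sym (T-scale (+ 2) x j)) (T-cong (sym ∘ Mu≡2x) j)) k ⟩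
        N (+ 3) (T (M u)) k              ≡⟨ T-N (+ 3) (M u) k ⟨
        T (N (+ 3) (M u)) k              ≡⟨ T-cong (N-comm (+ 3) m u) k ⟩
        T (F u) k                        ≡⟨ TF u k ⟩
        0ℤ                               ∎))

    extension : ∃ λ (x : ℤVec n) → (∀ k → IsUnit (x k)) × ⟨ x , x ⟩ ≡ r + 1ℤ × ⟨ x , T (T x) ⟩ ≡ - + 2 * r ×
      (∀ k → T (T (T x)) k + + 3 * T x k ≡ 0ℤ)
    extension = let a , da≡1 = heavy ; b , db≡0 = light ; open Extension a b da≡1 db≡0
                in x , x-unit , xx , xTTx , TTTx

-- The bordered matrix and its characteristic polynomial

module Bordering where

  open import Defs
  open Polynomials
  open Spectral
  open import Algebra.Bundles using (CommutativeRing)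
  open import Data.Bool using (if_then_else_)
  open import Data.Fin using (Fin; zero; suc; _≟_; inject₁; fromℕ)
  open import Data.Fin.Properties using (fromℕ≢inject₁)
  open import Data.Fin.Relation.Unary.Top using (view; ‵fromℕ; ‵inject₁)
  open import Data.Integer as ℤ using (ℤ; +_; -_; _+_; _*_; 0ℤ; 1ℤ; +≤+)
  import Data.Integer.Properties as ℤ
  open import Data.Integer.Tactic.RingSolver using (solve-∀)
  open import Data.List using ([])
  open import Data.Maybe using (just; nothing)
  import Data.Maybe as Maybe
  open import Data.Nat as ℕ using (ℕ; zero; suc)
  open import Data.Product using (∃; _×_; _,_; proj₁)
  open import Function using (_∘_)
  open import Relation.Binary.PropositionalEquality as ≡ using (_≡_; _≢_; refl; cong; cong₂; sym; trans; subst)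
  open import Relation.Nullary using (does; yes; no; contradiction)
  import Tactic.RingSolver as PolyRing
  open Σℤ using (sum)

  lastView-inject₁ : ∀ {n} (i : Fin n) → lastView (inject₁ i) ≡ just i
  lastView-inject₁ zero    = refl
  lastView-inject₁ (suc i) = cong (Maybe.map suc) (lastView-inject₁ i)

  lastView-fromℕ : ∀ n → lastView (fromℕ n) ≡ nothing
  lastView-fromℕ zero    = refl
  lastView-fromℕ (suc n) = cong (Maybe.map suc) (lastView-fromℕ n)

  module Border {n} (S : Matrix n) (x : Fin n → ℤ) where

    border-inner : ∀ i j → border S x (inject₁ i) (inject₁ j) ≡ S i j
    border-inner i j rewrite lastView-inject₁ i | lastView-inject₁ j = refl

    border-column : ∀ i → border S x (inject₁ i) (fromℕ n) ≡ x i
    border-column i rewrite lastView-inject₁ i | lastView-fromℕ n = refl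

    border-row : ∀ j → border S x (fromℕ n) (inject₁ j) ≡ - x j
    border-row j rewrite lastView-inject₁ j | lastView-fromℕ n = refl

    border-corner : border S x (fromℕ n) (fromℕ n) ≡ 0ℤ
    border-corner rewrite lastView-fromℕ n = refl

    border-skewSeidel : IsSkewSeidel S → (∀ i → IsUnit (x i)) → IsSkewSeidel (border S x)
    border-skewSeidel (diagonal , offDiagonal , skew) x-unit = diag , off , anti
      where
      diag : ∀ i → border S x i i ≡ 0ℤ
      diag i with view i
      ... | ‵fromℕ     = border-corner
      ... | ‵inject₁ i = trans (border-inner i i) (diagonal i)
      off : ∀ i j → i ≢ j → IsUnit (border S x i j)
      off i j i≢j with view i | view j
      ... | ‵fromℕ     | ‵fromℕ     = contradiction refl i≢j
      ... | ‵fromℕ     | ‵inject₁ j = subst IsUnit (sym (border-row j)) (unit-neg (x-unit j))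
      ... | ‵inject₁ i | ‵fromℕ     = subst IsUnit (sym (border-column i)) (x-unit i)
      ... | ‵inject₁ i | ‵inject₁ j = subst IsUnit (sym (border-inner i j)) (offDiagonal i j (i≢j ∘ cong inject₁))
      anti : ∀ i j → border S x j i ≡ - border S x i j
      anti i j with view i | view j
      ... | ‵fromℕ     | ‵fromℕ     = trans border-corner (cong -_ (sym border-corner))
      ... | ‵fromℕ     | ‵inject₁ j = trans (border-column j) (trans (sym (ℤ.neg-involutive (x j))) (cong -_ (sym (border-row j))))
      ... | ‵inject₁ i | ‵fromℕ     = trans (border-row i) (cong -_ (sym (border-column i)))
      ... | ‵inject₁ i | ‵inject₁ j = trans (border-inner j i) (trans (skew i j) (cong -_ (sym (border-inner i j))))

    A : Fin (suc n) → Fin (suc n) → Poly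
    A = charMatrix (border S x)

    A-inner : ∀ i j → A (inject₁ i) (inject₁ j) ≡ charMatrix S i j
    A-inner i j = cong₂ (λ b s → (if b then X else []) +P C (- s)) (does-inject₁ i j) (border-inner i j)
      where
      does-inject₁ : ∀ {n} (i j : Fin n) → does (inject₁ i ≟ inject₁ j) ≡ does (i ≟ j)
      does-inject₁ zero zero = refl
      does-inject₁ zero (suc j) = refl
      does-inject₁ (suc i) zero = refl
      does-inject₁ (suc i) (suc j) = does-inject₁ i j

    charMatrix-off : ∀ {m} (B : Matrix m) {i j} → i ≢ j → charMatrix B i j ≡ C (- B i j)
    charMatrix-off B {i} {j} i≢j with i ≟ j
    ... | yes i≡j = contradiction i≡j i≢j
    ... | no _    = refl

    charMatrix-diag : ∀ {m} (B : Matrix m) i → charMatrix B i i ≡ X +P C (- B i i)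
    charMatrix-diag B i with i ≟ i
    ... | yes _   = refl
    ... | no i≢i = contradiction refl i≢i

    A-column : ∀ i → A (inject₁ i) (fromℕ n) ≡ C (- x i)
    A-column i = trans (charMatrix-off (border S x) (fromℕ≢inject₁ ∘ sym)) (cong (C ∘ -_) (border-column i))

    A-row : ∀ j → A (fromℕ n) (inject₁ j) ≡ C (x j)
    A-row j = trans (charMatrix-off (border S x) fromℕ≢inject₁)
      (cong C (trans (cong -_ (border-row j)) (ℤ.neg-involutive (x j))))

    A-corner : A (fromℕ n) (fromℕ n) ≋ X
    A-corner = ≋-trans (CommutativeRing.reflexive polyRing
        (trans (charMatrix-diag (border S x) (fromℕ n)) (cong (λ s → X +P C (- s)) border-corner)))
      (≋-trans (+P-cong {X} ≋-refl C-0) (CommutativeRing.+-identityʳ polyRing X))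

  C-sum : ∀ {n} (f : Fin n → ℤ) → ΣP.sum (C ∘ f) ≋ C (sum f)
  C-sum {zero}  f = ≋-sym C-0
  C-sum {suc n} f = +P-cong {C (f zero)} ≋-refl (C-sum (f ∘ suc))

  C-dot : ∀ {n} (u v : Fin n → ℤ) → ΣP.sum (λ j → C (u j) *P C (v j)) ≋ C (sum (λ j → u j * v j))
  C-dot u v = ≋-trans (ΣP.sum-cong-≋ λ j → ≋-sym (C-* (u j) (v j))) (C-sum (λ j → u j * v j))

  module BorderedCharPoly {n} (S : Matrix n) (seidel : IsSkewSeidel S) (r : ℤ) (x : ℤVec n)
    (xx : ⟨ x , x ⟩ ≡ r + 1ℤ)
    (xTTx : ⟨ x , SkewSeidel.T S seidel (SkewSeidel.T S seidel x) ⟩ ≡ - + 2 * r)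
    (TTTx : ∀ k → SkewSeidel.T S seidel (SkewSeidel.T S seidel (SkewSeidel.T S seidel x)) k + + 3 * SkewSeidel.T S seidel x k ≡ 0ℤ)
    where

    open SkewSeidel S seidel
    open Border S x
    open CommutativeRing polyRing using (setoid)
    open import Relation.Binary.Reasoning.Setoid setoid

    Y : Poly
    Y = X *P X +P C (+ 3)

    -- Since S³x = −3 S x, p is X Y (X I − S)⁻¹ x; T acts on row vectors, so the column S x is − T x.
    p : Fin n → Poly
    p j = Y *P C (x j) +P negP X *P C (T x j) +P C (T (T x) j)

    -- Serves twice: with s a column of S in `p-row`, and with s = x in the last row of the bordered
    -- matrix.
    p-dot : ∀ (s : ℤVec n) → ΣP.sum (λ j → p j *P C (s j)) ≋
      Y *P C (sum (λ j → x j * s j)) +P negP X *P C (sum (λ j → T x j * s j)) +P C (sum (λ j → T (T x) j * s j))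
    p-dot s = begin
      ΣP.sum (λ j → p j *P C (s j))
        ≈⟨ ΣP.sum-cong-≋ (λ j → expand Y (negP X) (C (x j)) (C (T x j)) (C (T (T x) j)) (C (s j))) ⟩
      ΣP.sum (λ j → Y *P (C (x j) *P C (s j)) +P negP X *P (C (T x j) *P C (s j)) +P C (T (T x) j) *P C (s j))
        ≈⟨ ΣP.∑-distrib-+ (λ j → Y *P (C (x j) *P C (s j)) +P negP X *P (C (T x j) *P C (s j))) (λ j → C (T (T x) j) *P C (s j)) ⟩
      ΣP.sum (λ j → Y *P (C (x j) *P C (s j)) +P negP X *P (C (T x j) *P C (s j))) +P ΣP.sum (λ j → C (T (T x) j) *P C (s j))
        ≈⟨ +P-cong (≋-trans (ΣP.∑-distrib-+ (λ j → Y *P (C (x j) *P C (s j))) (λ j → negP X *P (C (T x j) *P C (s j))))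
             (+P-cong (≋-trans (≋-sym (ΣP.*-distribˡ-sum Y (λ j → C (x j) *P C (s j)))) (*P-congˡ Y (C-dot x s)))
                      (≋-trans (≋-sym (ΣP.*-distribˡ-sum (negP X) (λ j → C (T x j) *P C (s j)))) (*P-congˡ (negP X) (C-dot (T x) s)))))
             (C-dot (T (T x)) s) ⟩
      _ ∎
      where
      expand : ∀ y z a b c s → (y *P a +P z *P b +P c) *P s ≋ y *P (a *P s) +P z *P (b *P s) +P c *P s
      expand = PolyRing.solve-∀ polyACR

    -- By skew symmetry row i of -S is column i of S, so (X I - S) p is X p plus the row vector p S.
    p-row : ∀ i → ΣP.sum (λ j → p j *P charMatrix S i j) ≋
      p i *P X +P (Y *P C (T x i) +P negP X *P C (T (T x) i) +P C (T (T (T x)) i))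
    p-row i = begin
      ΣP.sum (λ j → p j *P charMatrix S i j)
        ≈⟨ ΣP.sum-cong-≋ entry ⟩
      ΣP.sum (λ j → X *P p j *P D.δ j i +P p j *P C (S j i))
        ≈⟨ ΣP.∑-distrib-+ (λ j → X *P p j *P D.δ j i) (λ j → p j *P C (S j i)) ⟩
      ΣP.sum (λ j → X *P p j *P D.δ j i) +P ΣP.sum (λ j → p j *P C (S j i))
        ≈⟨ +P-cong (≋-trans (D.sum-δ (λ j → X *P p j) i) (*P-comm X (p i))) (p-dot (λ j → S j i)) ⟩
      p i *P X +P (Y *P C (sum (λ j → x j * S j i)) +P negP X *P C (sum (λ j → T x j * S j i)) +P C (sum (λ j → T (T x) j * S j i)))
        ≡⟨ cong (p i *P X +P_) (≡.cong₂ _+P_ (cong₂ (λ a b → Y *P C a +P negP X *P C b) (sym (⊙-def x S i)) (sym (⊙-def (T x) S i)))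
             (cong C (sym (⊙-def (T (T x)) S i)))) ⟩
      p i *P X +P (Y *P C (T x i) +P negP X *P C (T (T x) i) +P C (T (T (T x)) i)) ∎
      where
      on : ∀ y p → p *P y ≋ y *P p *P C 1ℤ
      on = PolyRing.solve-∀ polyACR
      off : ∀ y p → p *P [] ≋ y *P p *P []
      off y p = ≋-trans (*P-[] p) (≋-sym (*P-[] (y *P p)))
      entry : ∀ j → p j *P charMatrix S i j ≋ X *P p j *P D.δ j i +P p j *P C (S j i)
      entry j = ≋-trans (*P-distribˡ (p j) (if does (i ≟ j) then X else []) (C (- S i j)))
        (+P-cong diagonal (CommutativeRing.reflexive polyRing (cong (λ s → p j *P C s) (sym (skew i j)))))
        where
        diagonal : p j *P (if does (i ≟ j) then X else []) ≋ X *P p j *P D.δ j i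
        diagonal with i ≟ j | j ≟ i
        ... | yes _    | yes _    = on X (p j)
        ... | no _     | no _     = off X (p j)
        ... | yes refl | no i≢i   = contradiction refl i≢i
        ... | no i≢i   | yes refl = contradiction refl i≢i

    -- This is (X I - S) p = X Y x: the terms in T (T x) cancel, and those in T x cancel because Y -
    -- 3 = X².
    cleared : ∀ i → X *P Y *P A (inject₁ i) (fromℕ n) +P ΣP.sum (λ j → p j *P A (inject₁ i) (inject₁ j)) ≋ []
    cleared i = begin
      X *P Y *P A (inject₁ i) (fromℕ n) +P ΣP.sum (λ j → p j *P A (inject₁ i) (inject₁ j))
        ≈⟨ +P-cong (CommutativeRing.reflexive polyRing (cong (X *P Y *P_) (A-column i)))
             (≋-trans (ΣP.sum-cong-≋ λ j → CommutativeRing.reflexive polyRing (cong (p j *P_) (A-inner i j))) (p-row i)) ⟩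
      X *P Y *P negP (C (x i)) +P (p i *P X +P (Y *P C (T x i) +P negP X *P C (T (T x) i) +P C (T (T (T x)) i)))
        ≈⟨ +P-cong {X *P Y *P negP (C (x i))} ≋-refl (+P-cong {p i *P X} ≋-refl (+P-cong {Y *P C (T x i) +P negP X *P C (T (T x) i)} ≋-refl cubic)) ⟩
      X *P Y *P negP (C (x i)) +P (p i *P X +P (Y *P C (T x i) +P negP X *P C (T (T x) i) +P negP (C (+ 3) *P C (T x i))))
        ≈⟨ identity X (C (+ 3)) (C (x i)) (C (T x i)) (C (T (T x) i)) ⟩
      [] ∎
      where
      cubic : C (T (T (T x)) i) ≋ negP (C (+ 3) *P C (T x i))
      cubic = ≋-trans (CommutativeRing.reflexive polyRing (cong C (isolate (TTTx i)))) (CommutativeRing.-‿cong polyRing (C-* (+ 3) (T x i)))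
        where
        isolate : ∀ {a b} → a + b ≡ 0ℤ → a ≡ - b
        isolate {a} {b} p = trans (split a b) (trans (cong (_+ - b) p) (ℤ.+-identityˡ (- b)))
          where
          split : ∀ a b → a ≡ a + b + - b
          split = solve-∀
      identity : ∀ y c a b d → y *P (y *P y +P c) *P negP a +P
        (((y *P y +P c) *P a +P negP y *P b +P d) *P y +P ((y *P y +P c) *P b +P negP y *P d +P negP (c *P b))) ≋ []
      identity = PolyRing.solve-∀ polyACR

    -- The odd term drops out because x is orthogonal to T x. What remains, X² Y + (r + 1) Y - 2 r =
    -- X⁴ + (r + 4) X² + r + 3, splits as stated.
    corner : X *P Y *P A (fromℕ n) (fromℕ n) +P ΣP.sum (λ j → p j *P A (fromℕ n) (inject₁ j)) ≋
      (X *P X +P C (r + + 3)) *P (X *P X +P C (+ 1))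
    corner = begin
      X *P Y *P A (fromℕ n) (fromℕ n) +P ΣP.sum (λ j → p j *P A (fromℕ n) (inject₁ j))
        ≈⟨ +P-cong (*P-congˡ (X *P Y) A-corner)
             (≋-trans (ΣP.sum-cong-≋ λ j → CommutativeRing.reflexive polyRing (cong (p j *P_) (A-row j))) (p-dot x)) ⟩
      X *P Y *P X +P (Y *P C (sum (λ j → x j * x j)) +P negP X *P C (sum (λ j → T x j * x j)) +P C (sum (λ j → T (T x) j * x j)))
        ≡⟨ cong (X *P Y *P X +P_) (≡.cong₂ _+P_ (cong₂ (λ a b → Y *P C a +P negP X *P C b)
             (trans (sym (dot-def x x)) xx) (trans (sym (dot-def (T x) x)) (dot-T x)))
             (cong C (trans (sym (dot-def (T (T x)) x)) (trans (dot-comm (T (T x)) x) xTTx)))) ⟩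
      X *P Y *P X +P (Y *P (C r +P C 1ℤ) +P negP X *P C 0ℤ +P C (- + 2 * r))
        ≈⟨ +P-cong {X *P Y *P X} ≋-refl (+P-cong {Y *P (C r +P C 1ℤ) +P negP X *P C 0ℤ} ≋-refl (C-* (- + 2) r)) ⟩
      X *P Y *P X +P (Y *P (C r +P C 1ℤ) +P negP X *P C 0ℤ +P C (- + 2) *P C r)
        ≈⟨ identity X (C r) ⟩
      (X *P X +P (C r +P C (+ 3))) *P (X *P X +P C (+ 1)) ∎
      where
      identity : ∀ y c → y *P (y *P y +P C (+ 3)) *P y +P ((y *P y +P C (+ 3)) *P (c +P C 1ℤ) +P negP y *P C 0ℤ +P C (- + 2) *P c) ≋
        (y *P y +P (c +P C (+ 3))) *P (y *P y +P C (+ 1))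
      identity = PolyRing.solve-∀ polyACR

    bordered-charPoly : X *P Y *P charPoly (border S x) ≋
      (X *P X +P C (r + + 3)) *P (X *P X +P C (+ 1)) *P charPoly S
    bordered-charPoly = begin
      X *P Y *P charPoly (border S x)
        ≈⟨ *P-congˡ (X *P Y) (det≋det A) ⟩
      X *P Y *P D.det A
        ≈⟨ D.det-clear-last-column A (X *P Y) p cleared ⟩
      _ ≈⟨ *P-cong corner (≋-trans (D.det-cong λ i j → CommutativeRing.reflexive polyRing (A-inner i j)) (≋-sym (det≋det (charMatrix S)))) ⟩
      (X *P X +P C (r + + 3)) *P (X *P X +P C (+ 1)) *P charPoly S ∎

  sum-ones : ∀ n → sum {n} (λ _ → 1ℤ) ≡ + n
  sum-ones zero    = refl
  sum-ones (suc n) = cong (_+_ 1ℤ) (sum-ones n)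

  -- The exponent l comes with a predecessor k because `annihilated` expects a positive power; o
  -- witnesses that the index set is inhabited.
  extend : ∀ {n} → Fin n → (S : Matrix n) → IsSkewSeidel S →
    ∀ t → 1 ℕ.≤ t → n ≡ 4 ℕ.* t ℕ.+ 1 → ∀ {l} k → l ≡ suc k →
    charPoly S ≈P ((X *P X +P C (+ (4 ℕ.* t ℕ.+ 3))) ^P l *P (X *P X +P C (+ 3)) *P X) →
    ∃ λ (x : Fin n → ℤ) → (∀ i → IsUnit (x i)) × IsSkewSeidel (border S x) ×
      charPoly (border S x) ≈P ((X *P X +P C (+ (4 ℕ.* t ℕ.+ 3))) ^P suc l *P (X *P X +P C (+ 1)))
  extend {n} o S seidel t 1≤t n≡4t+1 k refl spectrum =
    x , x-unit , border-skewSeidel seidel x-unit , at (X²+a*-cancel (+ 3) (X*-cancel cancelled))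
    where
    r : ℤ
    r = + (4 ℕ.* t)
    open SkewSeidel S seidel using (annihilated)
    open Structure o S seidel (+ t) r (+≤+ 1≤t) (ℤ.pos-* 4 t) (trans (sum-ones n) (cong +_ n≡4t+1))
      (annihilated (r + + 3) (+ 3) k spectrum) using (extension)
    x : Fin n → ℤ
    x = proj₁ extension
    x-unit : ∀ i → IsUnit (x i)
    x-unit = let _ , u , _ = extension in u
    open Border S x using (border-skewSeidel)
    P Y : Poly
    P = (X *P X +P C (r + + 3)) ^P suc k
    Y = X *P X +P C (+ 3)
    open CommutativeRing polyRing using (setoid)
    open import Relation.Binary.Reasoning.Setoid setoid
    -- The factors Y and X of `charPoly S` move to the front, where they match the multiplier X Y
    -- and can be cancelled.
    rotate : ∀ m y z p w → m *P w *P (p *P y *P z) ≋ z *P (y *P (m *P p *P w))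
    rotate = PolyRing.solve-∀ polyACR
    cancelled : X *P (Y *P charPoly (border S x)) ≋ X *P (Y *P ((X *P X +P C (r + + 3)) *P P *P (X *P X +P C (+ 1))))
    cancelled = begin
      X *P (Y *P charPoly (border S x))
        ≈⟨ *P-assoc X Y (charPoly (border S x)) ⟨
      X *P Y *P charPoly (border S x)
        ≈⟨ (let _ , _ , xx , xTTx , TTTx = extension in BorderedCharPoly.bordered-charPoly S seidel r x xx xTTx TTTx) ⟩
      (X *P X +P C (r + + 3)) *P (X *P X +P C (+ 1)) *P charPoly S
        ≈⟨ *P-congˡ ((X *P X +P C (r + + 3)) *P (X *P X +P C (+ 1))) (coeffs spectrum) ⟩
      (X *P X +P C (r + + 3)) *P (X *P X +P C (+ 1)) *P (P *P Y *P X)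
        ≈⟨ rotate (X *P X +P C (r + + 3)) Y X P (X *P X +P C (+ 1)) ⟩
      X *P (Y *P ((X *P X +P C (r + + 3)) *P P *P (X *P X +P C (+ 1)))) ∎

open import Defs
open import Data.Nat using (ℕ; suc; _+_; _*_; _∸_; _≤_)
open import Data.Integer using (ℤ; +_; 1ℤ; -1ℤ)
open import Data.Fin using (Fin; zero)
open import Data.Nat.Properties using (+-suc)
open import Data.Sum using (_⊎_)
open import Data.Product using (_×_; ∃)
open import Relation.Binary.PropositionalEquality using (_≡_; refl)

theorem4p14 : (t : ℕ) → 1 ≤ t →
    (S : Matrix (4 * t + 1)) → IsSkewSeidel S →
    charPoly S ≈P ((X *P X +P C (+ (4 * t + 3))) ^P (2 * t ∸ 1) *P (X *P X +P C (+ 3)) *P X) →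
    ∃ λ (x : Fin (4 * t + 1) → ℤ) →
    (∀ i → x i ≡ 1ℤ ⊎ x i ≡ -1ℤ) ×
    IsSkewSeidel (border S x) ×
    charPoly (border S x) ≈P ((X *P X +P C (+ (4 * t + 3))) ^P (2 * t) *P (X *P X +P C (+ 1)))
theorem4p14 (suc t) 1≤t S seidel spectrum =
  -- For t + 1 the exponent 2 (t + 1) ∸ 1 computes to t + suc (t + 0), the successor of t + (t + 0)
  -- by `+-suc`; the order is then visibly positive, so `zero` is an index.
  Bordering.extend zero S seidel (suc t) 1≤t refl (t + (t + 0)) (+-suc t (t + 0)) spectrum
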